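{- Let $T$ be an oriented tree on $n\ge 2$ vertices with non-zero edge weights in $\mathbb{C}\setminus\mathbb{R}^-$ and complex signless incidence matrix $N$. Then $\operatorname{vol}^2(N)=n\,|W_T|$.
   Context: An oriented tree is a directed graph obtained from a finite undirected tree by giving each edge exactly one direction. Each directed edge $(u,v)$ (from $u$ to $v$) has a non-zero complex weight $w_{uv}$; $\mathbb{R}^-$ denotes the negative real numbers and $\sqrt{\cdot}$ is the principal square root. The complex signless incidence matrix of $T$ (with edges $e_1,\dots,e_{n-1}$) is the $n\times(n-1)$ matrix $N=(n_{ij})$ where, for $e_j=(u,v)$, $n_{ij}=\sqrt{w_{uv}}$ if $i=u$, $n_{ij}=\sqrt{\overline{w_{uv}}}$ if $i=v$, and $n_{ij}=0$ otherwise. $W_T$ is the product of all edge weights of $T$. For a complex matrix $A$ of rank $r>0$, $\operatorname{vol}^2(A)$ is the sum of $|\det B|^2$ over all $r\times r$ submatrices $B$ of $A$. -}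

module Defs where

open import Algebra.Bundles.Raw using (RawRing)
import Algebra.Definitions.RawSemiring as RawSemiringDefinitions
open import Data.Fin.Base using (Fin; zero; suc; toℕ; inject₁; fromℕ; punchIn)
import Data.Integer.Base as ℤ
import Data.Integer.Properties as ℤP
open import Data.List.Base as List using (List; []; _∷_; _++_; cartesianProduct)
open import Data.Nat.Base as ℕ using (ℕ; zero; suc)
open import Data.Nat.Coprimality as Coprimality using (1-coprimeTo)
import Data.Nat.Properties as ℕP
open import Data.Product.Base using (∃-syntax; _×_; _,_; proj₁; proj₂)
open import Data.Rational.Base as Rat using (ℚ; mkℚ; 0ℚ; 1ℚ; ½; ∣_∣; *≤*)
import Data.Rational.Properties as ℚP
open import Data.Rational.Solver using (module +-*-Solver)
open import Data.Sum.Base using (_⊎_; inj₁; inj₂)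
open import Data.Vec.Functional as Vector using (Vector)
open import Function.Definitions using (Injective)
open import Level using (0ℓ; _⊔_)
open import Relation.Binary.Construct.Closure.ReflexiveTransitive using (Star)
open import Relation.Binary.PropositionalEquality
  using (_≡_; _≢_; refl; sym; trans; cong; cong₂; subst; subst₂)
open import Relation.Nullary using (¬_; Dec; yes; no; contradiction)

------------------------------------------------------------------------
-- Rational arithmetic

module _ where
  open Rat
  open ℚP
  open +-*-Solver

  <⇒≱ : ∀ {p q} → p < q → ¬ (q ≤ p)
  <⇒≱ p<q q≤p = <-irrefl refl (<-≤-trans p<q q≤p)

  ½*p>0 : ∀ {p} → 0ℚ < p → 0ℚ < ½ * p
  ½*p>0 {p} p>0 = positive⁻¹ (½ * p) {{pos*pos⇒pos ½ p {{positive p>0}}}}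

  *-pos : ∀ {p q} → 0ℚ < p → 0ℚ < q → 0ℚ < p * q
  *-pos {p} {q} p>0 q>0 =
    positive⁻¹ (p * q) {{pos*pos⇒pos p {{positive p>0}} q {{positive q>0}}}}

  ½*p+½*p≡p : ∀ p → ½ * p + ½ * p ≡ p
  ½*p+½*p≡p = solve 1 (λ p → con ½ :* p :+ con ½ :* p := p) refl

  p<q+r⇒p-q<r : ∀ {p q r} → p < q + r → p - q < r
  p<q+r⇒p-q<r {p} {q} {r} h =
    subst (p - q <_) (solve 2 (λ q r → q :+ r :- q := r) refl q r) (+-monoˡ-< (- q) h)

  p-q<r⇒p<q+r : ∀ {p q r} → p - q < r → p < q + r
  p-q<r⇒p<q+r {p} {q} {r} h =
    subst (_< q + r) (solve 2 (λ p q → q :+ (p :- q) := p) refl p q) (+-monoʳ-< q h)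

  p≤∣p∣ : ∀ p → p ≤ ∣ p ∣
  p≤∣p∣ p with ∣p∣≡p∨∣p∣≡-p p | 0≤∣p∣ p
  ... | inj₁ eq | _ = ≤-reflexive (sym eq)
  ... | inj₂ eq | h =
    ≤-trans (subst (_≤ 0ℚ) (solve 1 (λ p → :- (:- p) := p) refl p)
                   (neg-antimono-≤ (subst (0ℚ ≤_) eq h))) h

  ∣p∣<q : ∀ {p q} → p < q → - p < q → ∣ p ∣ < q
  ∣p∣<q {p} {q} h₁ h₂ with ∣p∣≡p∨∣p∣≡-p p
  ... | inj₁ eq = subst (_< q) (sym eq) h₁
  ... | inj₂ eq = subst (_< q) (sym eq) h₂

  ∣p-q∣<r : ∀ {p q r} → p < q + r → q < p + r → ∣ p - q ∣ < r
  ∣p-q∣<r {p} {q} {r} h₁ h₂ = ∣p∣<q (p<q+r⇒p-q<r h₁)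
    (subst (_< r) (solve 2 (λ p q → q :- p := :- (p :- q)) refl p q) (p<q+r⇒p-q<r h₂))

  ∣p-q∣<r⇒p<q+r : ∀ {p q r} → ∣ p - q ∣ < r → p < q + r
  ∣p-q∣<r⇒p<q+r {p} {q} h = p-q<r⇒p<q+r (≤-<-trans (p≤∣p∣ (p - q)) h)

  square-mono-≤ : ∀ {p q} → 0ℚ ≤ p → p ≤ q → p * p ≤ q * q
  square-mono-≤ {p} {q} 0≤p p≤q =
    ≤-trans (*-monoˡ-≤-nonNeg p {{nonNegative 0≤p}} p≤q)
            (*-monoʳ-≤-nonNeg q {{nonNegative (≤-trans 0≤p p≤q)}} p≤q)

  natℚ : ℕ → ℚ
  natℚ k = mkℚ (ℤ.+ k) 0 (Coprimality.sym (1-coprimeTo k))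

  1+natℚ : ∀ k → 1ℚ + natℚ k ≡ natℚ (suc k)
  1+natℚ k = trans
    (cong (λ i → (ℤ.+ 1 ℤ.+ i) / 1) (ℤP.*-identityʳ (ℤ.+ k)))
    (↥p/↧p≡p (natℚ (suc k)))

  natℚ-* : ∀ j k → natℚ j * natℚ k ≡ natℚ (j ℕ.* k)
  natℚ-* j k = trans (cong (_/ 1) (sym (ℤP.pos-* j k))) (↥p/↧p≡p (natℚ (j ℕ.* k)))

  1/1+ : ℕ → ℚ
  1/1+ n = mkℚ (ℤ.+ 1) n (1-coprimeTo (suc n))

  1/1+-antimono : ∀ {m n} → m ℕ.≤ n → 1/1+ n ≤ 1/1+ m
  1/1+-antimono m≤n = *≤* (ℤP.*-monoˡ-≤-nonNeg (ℤ.+ 1) (ℤ.+≤+ (ℕ.s≤s m≤n)))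

  1/1+-archimedean : ∀ {p} → 0ℚ < p → ∃[ n ] 1/1+ n ≤ p
  1/1+-archimedean {p} p>0 with p | positive p>0
  ... | mkℚ (ℤ.+ suc a) d _ | _ =
    d , *≤* (ℤP.*-monoʳ-≤-nonNeg (ℤ.+ suc d) {ℤ.+ 1} {ℤ.+ suc a} (ℤ.+≤+ (ℕ.s≤s ℕ.z≤n)))

  1/1+>0 : ∀ n → 0ℚ < 1/1+ n
  1/1+>0 n = positive⁻¹ (1/1+ n)

  p<natℚ : ∀ p → p < natℚ (suc ℤ.∣ ↥ p ∣)
  p<natℚ (mkℚ (ℤ.+ a) d _) = *<* (subst₂ ℤ._<_
    (sym (ℤP.*-identityʳ (ℤ.+ a))) (ℤP.pos-* (suc a) (suc d))
    (ℤ.+<+ (ℕP.m≤m*n (suc a) (suc d))))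
  p<natℚ p@(mkℚ (ℤ.-[1+ a ]) d _) = neg<pos p (natℚ (suc (suc a)))

------------------------------------------------------------------------
-- Square roots of rationals up to a given precision

module _ where
  open Rat
  open ℚP
  open +-*-Solver

  climb : (δ q : ℚ) → ℕ → ℚ
  climbFrom : (δ q r : ℚ) → Dec ((r + δ) * (r + δ) ≤ q) → ℚ
  climb δ q zero    = 0ℚ
  climb δ q (suc k) = climbFrom δ q (climb δ q k) (_ ≤? q)
  climbFrom δ q r (yes _) = r + δ
  climbFrom δ q r (no _)  = r

  record Climbed (δ q : ℚ) (k : ℕ) (r : ℚ) : Set where
    field
      nonneg : 0ℚ ≤ r
      lower  : r ≡ 0ℚ ⊎ r * r ≤ q
      upper  : q < (r + δ) * (r + δ) ⊎ r ≡ natℚ k * δ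

  climbed : ∀ {δ q} → 0ℚ < δ → ∀ k → Climbed δ q k (climb δ q k)
  climbed {δ} δ>0 zero = record
    { nonneg = ≤-refl ; lower = inj₁ refl ; upper = inj₂ (sym (*-zeroˡ δ)) }
  climbed {δ} {q} δ>0 (suc k) = step (climbed δ>0 k) (_ ≤? q)
    where
    step : ∀ {r} → Climbed δ q k r → (d : Dec ((r + δ) * (r + δ) ≤ q)) →
           Climbed δ q (suc k) (climbFrom δ q r d)
    step {r} c (yes p) = record
      { nonneg = +-mono-≤ nonneg (<⇒≤ δ>0)
      ; lower  = inj₂ p
      ; upper  = up upper
      }
      where
      open Climbed c
      up : q < (r + δ) * (r + δ) ⊎ r ≡ natℚ k * δ →
           q < (r + δ + δ) * (r + δ + δ) ⊎ r + δ ≡ natℚ (suc k) * δ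
      up (inj₁ h)    = contradiction p (<⇒≱ h)
      up (inj₂ refl) = inj₂ (trans
        (solve 2 (λ a δ → a :* δ :+ δ := (con 1ℚ :+ a) :* δ) refl (natℚ k) δ)
        (cong (_* δ) (1+natℚ k)))
    step c (no ¬p) = record
      { nonneg = nonneg ; lower = lower ; upper = inj₁ (≰⇒> ¬p) }
      where open Climbed c

  opaque
    climbs : ℕ → ℚ → ℕ
    climbs n q = suc ℤ.∣ ↥ q ∣ ℕ.* suc n

    -- The largest multiple r of δ = 1/(n+1) with r² ≤ q, or 0 if q < 0: start at
    -- 0 and go up by δ, at most (∣numerator of q∣ + 1)/δ times, which is enough
    -- because (∣numerator of q∣ + 1)² > q.
    √≈ : ℕ → ℚ → ℚ
    √≈ n q = climb (1/1+ n) q (climbs n q)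

    √≈-climbed : ∀ n q → Climbed (1/1+ n) q (climbs n q) (√≈ n q)
    √≈-climbed n q = climbed (1/1+>0 n) (climbs n q)

    √≈-nonneg : ∀ n q → 0ℚ ≤ √≈ n q
    √≈-nonneg n q = Climbed.nonneg {1/1+ n} {q} {climbs n q} (√≈-climbed n q)

    √≈-lower : ∀ n q → √≈ n q ≡ 0ℚ ⊎ √≈ n q * √≈ n q ≤ q
    √≈-lower n q = Climbed.lower {1/1+ n} {q} {climbs n q} (√≈-climbed n q)

    √≈-upper : ∀ n q → q < (√≈ n q + 1/1+ n) * (√≈ n q + 1/1+ n)
    √≈-upper n q with Climbed.upper {1/1+ n} {q} {climbs n q} (√≈-climbed n q)
    ... | inj₁ h  = h
    ... | inj₂ eq = <-≤-trans (p<natℚ q) (≤-trans M≤M² (square-mono-≤ 0≤M M≤r+δ))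
      where
      M : ℚ
      M = natℚ (suc ℤ.∣ ↥ q ∣)
      0≤M : 0ℚ ≤ M
      0≤M = nonNegative⁻¹ M
      1≤M : 1ℚ ≤ M
      1≤M = *≤* (ℤ.+≤+ (ℕ.s≤s ℕ.z≤n))
      M≤M² : M ≤ M * M
      M≤M² = subst (_≤ M * M) (*-identityʳ M) (*-monoˡ-≤-nonNeg M 1≤M)
      r≡M : √≈ n q ≡ M
      r≡M = trans eq (trans
        (cong (_* 1/1+ n) (sym (natℚ-* (suc ℤ.∣ ↥ q ∣) (suc n))))
        (trans (*-assoc M (natℚ (suc n)) (1/1+ n))
        (trans (cong (M *_) (*-inverseʳ (natℚ (suc n)))) (*-identityʳ M))))
      M≤r+δ : M ≤ √≈ n q + 1/1+ n
      M≤r+δ = subst₂ _≤_ (+-identityʳ M) (cong (_+ 1/1+ n) (sym r≡M))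
                     (+-monoʳ-≤ M (<⇒≤ (1/1+>0 n)))

  square-gap : ∀ {δ r s p q} → 0ℚ < δ → 0ℚ ≤ s → p < q + δ * δ →
               r ≡ 0ℚ ⊎ r * r ≤ p → q < (s + δ) * (s + δ) → r < s + (δ + δ)
  square-gap {δ} {r} {s} {p} {q} δ>0 0≤s p<q+δ² r-lower q<[s+δ]² = ≰⇒> (absurd r-lower)
    where
    0≤δ : 0ℚ ≤ δ
    0≤δ = <⇒≤ δ>0
    0≤s+2δ : 0ℚ ≤ s + (δ + δ)
    0≤s+2δ = +-mono-≤ 0≤s (+-mono-≤ 0≤δ 0≤δ)
    0≤gap : 0ℚ ≤ (s + (δ + δ) + s) * δ
    0≤gap = nonNegative⁻¹ _ {{nonNeg*nonNeg⇒nonNeg (s + (δ + δ) + s)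
      {{nonNegative (+-mono-≤ 0≤s+2δ 0≤s)}} δ {{nonNegative 0≤δ}}}}
    expand : (s + δ) * (s + δ) + δ * δ ≤ (s + (δ + δ)) * (s + (δ + δ))
    expand = subst₂ _≤_ (+-identityʳ _)
      (solve 2 (λ s δ → (s :+ δ) :* (s :+ δ) :+ δ :* δ :+ (s :+ (δ :+ δ) :+ s) :* δ
                     := (s :+ (δ :+ δ)) :* (s :+ (δ :+ δ))) refl s δ)
      (+-monoʳ-≤ ((s + δ) * (s + δ) + δ * δ) 0≤gap)
    absurd : r ≡ 0ℚ ⊎ r * r ≤ p → ¬ (s + (δ + δ) ≤ r)
    absurd (inj₁ r≡0)  h = <⇒≱ (+-mono-≤-< 0≤s (+-mono-< δ>0 δ>0)) (subst (s + (δ + δ) ≤_) r≡0 h)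
    absurd (inj₂ r²≤p) h = <-irrefl refl (<-≤-trans p<q+δ²
      (≤-trans (+-monoˡ-≤ (δ * δ) (<⇒≤ q<[s+δ]²))
      (≤-trans expand (≤-trans (square-mono-≤ 0≤s+2δ h) r²≤p))))

  √≈-close : ∀ m n {δ p q} → 0ℚ < δ → 1/1+ n ≤ δ → p < q + δ * δ →
             √≈ m p < √≈ n q + (δ + δ)
  √≈-close m n {δ} {p} {q} δ>0 1/n≤δ p<q+δ² =
    square-gap δ>0 (√≈-nonneg n q) p<q+δ² (√≈-lower m p)
      (<-≤-trans (√≈-upper n q)
        (square-mono-≤ (+-mono-≤ (√≈-nonneg n q) (<⇒≤ (1/1+>0 n)))
                       (+-monoʳ-≤ (√≈ n q) 1/n≤δ)))

------------------------------------------------------------------------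
-- Real numbers: Cauchy sequences of rationals, with the usual equality

module _ where
  open Rat
  open ℚP
  open +-*-Solver

  IsCauchy : (ℕ → ℚ) → Set
  IsCauchy x = ∀ ε → 0ℚ < ε →
    ∃[ N ] (∀ m n → N ℕ.≤ m → N ℕ.≤ n → ∣ x m - x n ∣ < ε)

  record ℝ : Set where
    constructor mkℝ
    field
      approx : ℕ → ℚ
      cauchy : IsCauchy approx

  open ℝ public

  infix 4 _≈ᵣ_ _≤ᵣ_ _<ᵣ_

  record _≈ᵣ_ (x y : ℝ) : Set where
    constructor mk≈
    field
      close : ∀ ε → 0ℚ < ε →
        ∃[ N ] (∀ n → N ℕ.≤ n → ∣ approx x n - approx y n ∣ < ε)

  record _≤ᵣ_ (x y : ℝ) : Set where
    constructor mk≤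
    field
      below : ∀ ε → 0ℚ < ε →
        ∃[ N ] (∀ n → N ℕ.≤ n → approx x n < approx y n + ε)

  record _<ᵣ_ (x y : ℝ) : Set where
    constructor mk<
    field
      gap   : ℚ
      gap>0 : 0ℚ < gap
      apart : ∃[ N ] (∀ n → N ℕ.≤ n → approx x n + gap < approx y n)

  opaque
    constant-cauchy : ∀ p → IsCauchy (λ _ → p)
    constant-cauchy p ε ε>0 =
      0 , λ _ _ _ _ → subst (λ d → ∣ d ∣ < ε) (sym (+-inverseʳ p)) ε>0

    +-cauchy : ∀ x y → IsCauchy x → IsCauchy y → IsCauchy (λ n → x n + y n)
    +-cauchy x y cx cy ε ε>0 with cx (½ * ε) (½*p>0 ε>0) | cy (½ * ε) (½*p>0 ε>0)
    ... | M , hx | N , hy = M ℕ.⊔ N , λ m n ≤m ≤n → begin-strict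
      ∣ x m + y m - (x n + y n) ∣
        ≡⟨ cong ∣_∣ (solve 4 (λ a b a₁ b₁ → a :+ b :- (a₁ :+ b₁) := a :- a₁ :+ (b :- b₁))
                           refl (x m) (y m) (x n) (y n)) ⟩
      ∣ x m - x n + (y m - y n) ∣
        ≤⟨ ∣p+q∣≤∣p∣+∣q∣ (x m - x n) (y m - y n) ⟩
      ∣ x m - x n ∣ + ∣ y m - y n ∣
        <⟨ +-mono-< (hx m n (ℕP.m⊔n≤o⇒m≤o M N ≤m) (ℕP.m⊔n≤o⇒m≤o M N ≤n))
                    (hy m n (ℕP.m⊔n≤o⇒n≤o M N ≤m) (ℕP.m⊔n≤o⇒n≤o M N ≤n)) ⟩
      ½ * ε + ½ * ε
        ≡⟨ ½*p+½*p≡p ε ⟩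
      ε ∎
      where open ≤-Reasoning

    neg-cauchy : ∀ x → IsCauchy x → IsCauchy (λ n → - x n)
    neg-cauchy x cx ε ε>0 =
      proj₁ (cx ε ε>0) , λ m n ≤m ≤n → subst (_< ε)
        (trans (sym (∣-p∣≡∣p∣ (x m - x n)))
               (cong ∣_∣ (solve 2 (λ a b → :- (a :- b) := :- a :- :- b) refl (x m) (x n))))
        (proj₂ (cx ε ε>0) m n ≤m ≤n)

  eventually-bounded : ∀ {x} → IsCauchy x →
    ∃[ B ] (0ℚ < B × ∃[ N ] (∀ n → N ℕ.≤ n → ∣ x n ∣ ≤ B))
  eventually-bounded {x} cx with cx 1ℚ (positive⁻¹ 1ℚ)
  ... | N , h = ∣ x N ∣ + 1ℚ , +-mono-≤-< (0≤∣p∣ (x N)) (positive⁻¹ 1ℚ) , N , λ n ≤n → begin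
    ∣ x n ∣
      ≡⟨ cong ∣_∣ (solve 2 (λ a b → a := b :+ (a :- b)) refl (x n) (x N)) ⟩
    ∣ x N + (x n - x N) ∣
      ≤⟨ ∣p+q∣≤∣p∣+∣q∣ (x N) (x n - x N) ⟩
    ∣ x N ∣ + ∣ x n - x N ∣
      ≤⟨ +-monoʳ-≤ ∣ x N ∣ (<⇒≤ (h n N ≤n ℕP.≤-refl)) ⟩
    ∣ x N ∣ + 1ℚ ∎
    where open ≤-Reasoning

  product-estimate : ∀ {B C i ε} a b a₁ b₁ → 0ℚ < B → 0ℚ < C → (B + C) * i ≡ 1ℚ →
    ∣ a ∣ ≤ B → ∣ b₁ ∣ ≤ C → ∣ a - a₁ ∣ < ε * i → ∣ b - b₁ ∣ < ε * i →
    ∣ a * b - a₁ * b₁ ∣ < ε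
  product-estimate {B} {C} {i} {ε} a b a₁ b₁ B>0 C>0 inv a≤B b₁≤C da db = begin-strict
    ∣ a * b - a₁ * b₁ ∣
      ≡⟨ cong ∣_∣ (solve 4 (λ a b a₁ b₁ →
           a :* b :- a₁ :* b₁ := a :* (b :- b₁) :+ b₁ :* (a :- a₁)) refl a b a₁ b₁) ⟩
    ∣ a * (b - b₁) + b₁ * (a - a₁) ∣
      ≤⟨ ∣p+q∣≤∣p∣+∣q∣ (a * (b - b₁)) (b₁ * (a - a₁)) ⟩
    ∣ a * (b - b₁) ∣ + ∣ b₁ * (a - a₁) ∣
      ≡⟨ cong₂ _+_ (∣p*q∣≡∣p∣*∣q∣ a (b - b₁)) (∣p*q∣≡∣p∣*∣q∣ b₁ (a - a₁)) ⟩
    ∣ a ∣ * ∣ b - b₁ ∣ + ∣ b₁ ∣ * ∣ a - a₁ ∣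
      ≤⟨ +-mono-≤
           (*-monoʳ-≤-nonNeg ∣ b - b₁ ∣ {{∣-∣-nonNeg (b - b₁)}} a≤B)
           (*-monoʳ-≤-nonNeg ∣ a - a₁ ∣ {{∣-∣-nonNeg (a - a₁)}} b₁≤C) ⟩
    B * ∣ b - b₁ ∣ + C * ∣ a - a₁ ∣
      <⟨ +-mono-< (*-monoʳ-<-pos B {{positive B>0}} db) (*-monoʳ-<-pos C {{positive C>0}} da) ⟩
    B * (ε * i) + C * (ε * i)
      ≡⟨ solve 4 (λ B C ε i → B :* (ε :* i) :+ C :* (ε :* i) := ε :* ((B :+ C) :* i))
               refl B C ε i ⟩
    ε * ((B + C) * i)
      ≡⟨ cong (ε *_) inv ⟩
    ε * 1ℚ
      ≡⟨ *-identityʳ ε ⟩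
    ε ∎
    where open ≤-Reasoning

  positive-inverse : ∀ p → 0ℚ < p → ∃[ i ] (0ℚ < i × p * i ≡ 1ℚ)
  positive-inverse p p>0 =
    1/ p , positive⁻¹ (1/ p) {{1/pos⇒pos p}} , *-inverseʳ p
    where
    instance
      p-positive : Positive p
      p-positive = positive p>0
      p-nonZero : NonZero p
      p-nonZero = pos⇒nonZero p

  opaque
    *-cauchy : ∀ x y → IsCauchy x → IsCauchy y → IsCauchy (λ n → x n * y n)
    *-cauchy x y cx cy ε ε>0 =
      let B , B>0 , K , hB = eventually-bounded cx
          C , C>0 , L , hC = eventually-bounded cy
          i , i>0 , inv    = positive-inverse (B + C) (+-mono-< B>0 C>0)
          P , hx           = cx (ε * i) (*-pos ε>0 i>0)
          Q , hy           = cy (ε * i) (*-pos ε>0 i>0)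
      in (K ℕ.⊔ L) ℕ.⊔ (P ℕ.⊔ Q) , λ m n ≤m ≤n →
      let N₁≤m = ℕP.m⊔n≤o⇒m≤o (K ℕ.⊔ L) (P ℕ.⊔ Q) ≤m
          N₁≤n = ℕP.m⊔n≤o⇒m≤o (K ℕ.⊔ L) (P ℕ.⊔ Q) ≤n
          N₂≤m = ℕP.m⊔n≤o⇒n≤o (K ℕ.⊔ L) (P ℕ.⊔ Q) ≤m
          N₂≤n = ℕP.m⊔n≤o⇒n≤o (K ℕ.⊔ L) (P ℕ.⊔ Q) ≤n
      in product-estimate (x m) (y m) (x n) (y n) B>0 C>0 inv
           (hB m (ℕP.m⊔n≤o⇒m≤o K L N₁≤m)) (hC n (ℕP.m⊔n≤o⇒n≤o K L N₁≤n))
           (hx m n (ℕP.m⊔n≤o⇒m≤o P Q N₂≤m) (ℕP.m⊔n≤o⇒m≤o P Q N₂≤n))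
           (hy m n (ℕP.m⊔n≤o⇒n≤o P Q N₂≤m) (ℕP.m⊔n≤o⇒n≤o P Q N₂≤n))

    √≈-cauchy : ∀ {x} → IsCauchy x → ∀ δ → 0ℚ < δ →
      ∃[ N ] (∀ m n → N ℕ.≤ m → N ℕ.≤ n → ∣ √≈ m (x m) - √≈ n (x n) ∣ < δ + δ)
    √≈-cauchy {x} cx δ δ>0 =
      let M , 1/M≤δ = 1/1+-archimedean δ>0
          N , hx    = cx (δ * δ) (*-pos δ>0 δ>0)
      in M ℕ.⊔ N , λ m n ≤m ≤n →
      let M≤m = ℕP.m⊔n≤o⇒m≤o M N ≤m
          M≤n = ℕP.m⊔n≤o⇒m≤o M N ≤n
          N≤m = ℕP.m⊔n≤o⇒n≤o M N ≤m
          N≤n = ℕP.m⊔n≤o⇒n≤o M N ≤n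
      in ∣p-q∣<r
           (√≈-close m n δ>0 (≤-trans (1/1+-antimono M≤n) 1/M≤δ) (∣p-q∣<r⇒p<q+r (hx m n N≤m N≤n)))
           (√≈-close n m δ>0 (≤-trans (1/1+-antimono M≤m) 1/M≤δ) (∣p-q∣<r⇒p<q+r (hx n m N≤n N≤m)))

    √-cauchy : ∀ x → IsCauchy x → IsCauchy (λ n → √≈ n (x n))
    √-cauchy x cx ε ε>0 =
      subst (λ e → ∃[ N ] (∀ m n → N ℕ.≤ m → N ℕ.≤ n → ∣ √≈ m (x m) - √≈ n (x n) ∣ < e))
            (½*p+½*p≡p ε) (√≈-cauchy cx (½ * ε) (½*p>0 ε>0))

  fromℚ : ℚ → ℝ
  fromℚ p = mkℝ (λ _ → p) (constant-cauchy p)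

  0ᵣ 1ᵣ : ℝ
  0ᵣ = fromℚ 0ℚ
  1ᵣ = fromℚ 1ℚ

  infixl 6 _+ᵣ_
  infixl 7 _*ᵣ_
  infix  8 -ᵣ_

  _+ᵣ_ : ℝ → ℝ → ℝ
  x +ᵣ y = mkℝ (λ n → approx x n + approx y n) (+-cauchy (approx x) (approx y) (cauchy x) (cauchy y))

  -ᵣ_ : ℝ → ℝ
  -ᵣ x = mkℝ (λ n → - approx x n) (neg-cauchy (approx x) (cauchy x))

  _*ᵣ_ : ℝ → ℝ → ℝ
  x *ᵣ y = mkℝ (λ n → approx x n * approx y n) (*-cauchy (approx x) (approx y) (cauchy x) (cauchy y))

  -- Extended by √x = 0 for x ≤ 0.
  √ᵣ : ℝ → ℝ
  √ᵣ x = mkℝ (λ n → √≈ n (approx x n)) (√-cauchy (approx x) (cauchy x))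

ℝ-rawRing : RawRing 0ℓ 0ℓ
ℝ-rawRing = record
  { Carrier = ℝ ; _≈_ = _≈ᵣ_ ; _+_ = _+ᵣ_ ; _*_ = _*ᵣ_ ; -_ = -ᵣ_ ; 0# = 0ᵣ ; 1# = 1ᵣ }

open RawSemiringDefinitions (RawRing.rawSemiring ℝ-rawRing) public
  using () renaming (_×_ to _×ᵣ_)

------------------------------------------------------------------------
-- Complex numbers

infix 4 _≈ᶜ_

record ℂ : Set where
  constructor _+i_
  field
    re im : ℝ

open ℂ public

record _≈ᶜ_ (z w : ℂ) : Set where
  constructor mk≈ᶜ
  field
    re-≈ : re z ≈ᵣ re w
    im-≈ : im z ≈ᵣ im w

ℂ-rawRing : RawRing 0ℓ 0ℓ
ℂ-rawRing = record
  { Carrier = ℂ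
  ; _≈_     = _≈ᶜ_
  ; _+_     = λ z w → (re z +ᵣ re w) +i (im z +ᵣ im w)
  ; _*_     = λ z w → (re z *ᵣ re w +ᵣ -ᵣ (im z *ᵣ im w)) +i (re z *ᵣ im w +ᵣ im z *ᵣ re w)
  ; -_      = λ z → (-ᵣ re z) +i (-ᵣ im z)
  ; 0#      = 0ᵣ +i 0ᵣ
  ; 1#      = 1ᵣ +i 0ᵣ
  }

open RawRing ℂ-rawRing public
  using () renaming (_+_ to _+ᶜ_; _*_ to _*ᶜ_; -_ to -ᶜ_; 0# to 0ᶜ; 1# to 1ᶜ)
open RawSemiringDefinitions (RawRing.rawSemiring ℂ-rawRing) public
  using () renaming (product to productᶜ)

conj : ℂ → ℂ
conj z = re z +i (-ᵣ im z)

∣_∣ᶜ : ℂ → ℝ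
∣ z ∣ᶜ = √ᵣ (re z *ᵣ re z +ᵣ im z *ᵣ im z)

_∈ℝ⁻ : ℂ → Set
z ∈ℝ⁻ = re z <ᵣ 0ᵣ × im z ≈ᵣ 0ᵣ

-- s is the principal square root of z: the root with argument in (-π/2, π/2].
-- A relation, because the branch cut prevents the principal root from being a
-- total function on ℂ constructively.
record IsPrincipalSqrt (z s : ℂ) : Set where
  field
    isRoot       : s *ᶜ s ≈ᶜ z
    re-nonneg    : 0ᵣ ≤ᵣ re s
    im-on-border : re s ≈ᵣ 0ᵣ → 0ᵣ ≤ᵣ im s

------------------------------------------------------------------------
-- Matrices

-- All strictly increasing maps Fin r → Fin n, each listed once; they stand for
-- the r-element subsets of Fin n.
increasing : ∀ r n → List (Fin r → Fin n)
increasing zero    n       = (λ ()) ∷ []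
increasing (suc r) zero    = []
increasing (suc r) (suc n) =
  List.map (λ f → zero Vector.∷ λ i → suc (f i)) (increasing r n) ++
  List.map (λ f i → suc (f i)) (increasing (suc r) n)

module LinearAlgebra {c ℓ} (R : RawRing c ℓ) where
  open RawRing R
  open RawSemiringDefinitions rawSemiring using (sum; _^_)

  Matrix : ℕ → ℕ → Set c
  Matrix n m = Vector (Vector Carrier m) n

  submatrix : ∀ {n m r s} → (Fin r → Fin n) → (Fin s → Fin m) → Matrix n m → Matrix r s
  submatrix f g A i j = A (f i) (g j)

  -- Cofactor expansion along the first row.
  det : ∀ {n} → Matrix n n → Carrier
  det {zero}  A = 1#
  det {suc n} A = sum λ j →
    (- 1#) ^ toℕ j * A zero j * det (submatrix suc (punchIn j) A)

  column : ∀ {n m} → Matrix n m → Vector (Vector Carrier n) m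
  column A j i = A i j

  combination : ∀ {n k} → Vector Carrier k → Vector (Vector Carrier n) k → Vector Carrier n
  combination a v i = sum λ j → a j * v j i

  LinearlyIndependent : ∀ {n k} → Vector (Vector Carrier n) k → Set (c ⊔ ℓ)
  LinearlyIndependent v = ∀ a → (∀ i → combination a v i ≈ 0#) → ∀ j → a j ≈ 0#

  _∈Span_ : ∀ {n k} → Vector Carrier n → Vector (Vector Carrier n) k → Set (c ⊔ ℓ)
  x ∈Span v = ∃[ a ] (∀ i → x i ≈ combination a v i)

  -- The column space of A has a basis with r elements.
  record HasRank {n m} (A : Matrix n m) (r : ℕ) : Set (c ⊔ ℓ) where
    field
      basis         : Vector (Vector Carrier n) r
      independent   : LinearlyIndependent basis
      inColumnSpace : ∀ k → basis k ∈Span column A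
      spanning      : ∀ j → column A j ∈Span basis

open LinearAlgebra ℂ-rawRing public

sumOfSquaredMinors : ∀ {n m} → ℕ → Matrix n m → ℝ
sumOfSquaredMinors {n} {m} r A = List.foldr _+ᵣ_ 0ᵣ
  (List.map (λ { (f , g) → ∣ det (submatrix f g A) ∣ᶜ *ᵣ ∣ det (submatrix f g A) ∣ᶜ })
            (cartesianProduct (increasing r n) (increasing r m)))

-- v = vol²(A), where the rank r of A is positive.
IsVol² : ∀ {n m} → Matrix n m → ℝ → Set
IsVol² A v = ∃[ r ] (HasRank A r × 0 ℕ.< r × sumOfSquaredMinors r A ≈ᵣ v)

------------------------------------------------------------------------
-- Oriented trees

-- The vertices are Fin n and the edges Fin m, edge e going from src e to tgt e.
-- That m = n - 1 is a consequence of the axioms and is not assumed.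
record OrientedTree (n m : ℕ) : Set where
  field
    src tgt : Fin m → Fin n

  Adjacent : Fin n → Fin n → Set
  Adjacent u v = ∃[ e ] ((src e ≡ u × tgt e ≡ v) ⊎ (src e ≡ v × tgt e ≡ u))

  field
    loopless  : ∀ e → src e ≢ tgt e
    -- No parallel edges, in the same or in opposite directions.
    simple    : ∀ e f → (src e ≡ src f × tgt e ≡ tgt f) ⊎ (src e ≡ tgt f × tgt e ≡ src f) →
                e ≡ f
    connected : ∀ u v → Star Adjacent u v
    acyclic   : ∀ k (c : Fin (3 ℕ.+ k) → Fin n) → Injective _≡_ _≡_ c →
                (∀ (i : Fin (2 ℕ.+ k)) → Adjacent (c (inject₁ i)) (c (suc i))) →
                ¬ Adjacent (c (fromℕ (2 ℕ.+ k))) (c zero)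

record IsSignlessIncidenceMatrix {n m} (T : OrientedTree n m) (w : Fin m → ℂ)
                                 (N : Matrix n m) : Set where
  open OrientedTree T
  field
    at-src : ∀ e → IsPrincipalSqrt (w e) (N (src e) e)
    at-tgt : ∀ e → IsPrincipalSqrt (conj (w e)) (N (tgt e) e)
    off    : ∀ i e → i ≢ src e → i ≢ tgt e → N i e ≈ᶜ 0ᶜ

{-# OPTIONS --safe #-}
module Submission where

-- Root T at the vertex whose row is deleted. Matching every other vertex with the
-- edge towards the root is the only way to match these vertices with incident
-- edges, because a vertex of maximal depth is incident to one edge only. So in the
-- expansion of the minor d a single term survives, and d² is the product of the
-- squares of its entries, each of them w_e or its conjugate. Hence |d|² = |W_T| for
-- each of the n minors. Stripping the deepest vertices in turn also shows that the
-- columns are independent, so the rank is n - 1.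

open import Defs
open import Algebra.Bundles using (CommutativeRing)
open import Algebra.Bundles.Raw using (RawRing)
import Algebra.Definitions.RawSemiring as RawSemiringDefinitions
import Algebra.Properties.CommutativeMonoid.Sum as CommutativeMonoidSum
import Algebra.Properties.CommutativeSemigroup as CommutativeSemigroupProperties
import Algebra.Properties.Ring as RingProperties
import Algebra.Properties.Semiring.Sum as SemiringSum
open import Data.Fin.Base using (Fin; zero; suc; toℕ; inject₁; fromℕ; punchIn; punchOut)
open import Data.Fin.Permutation using (Permutation′; permutation)
import Data.Fin.Properties as FinP
open import Data.List.Base as List
  using (List; []; _∷_; _++_; length; lookup; allFin; cartesianProduct)
import Data.List.Membership.DecPropositional as DecMembership
open import Data.List.Membership.Propositional using (_∈_; _∉_)
open import Data.List.Membership.Propositional.Properties using (∈-lookup; ∈-++⁻; ∈-allFin)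
import Data.List.Properties as ListP
open import Data.List.Relation.Binary.Subset.Propositional using (_⊆_)
open import Data.List.Relation.Unary.All as All using (All; []; _∷_)
import Data.List.Relation.Unary.All.Properties as AllP
open import Data.List.Relation.Unary.Any using (here; there)
open import Data.Nat.Base as ℕ using (ℕ; zero; suc)
import Data.Nat.Properties as ℕP
open import Data.Product.Base using (∃-syntax; _×_; _,_; proj₁; proj₂)
open import Data.Rational.Base as Rat using (ℚ; 0ℚ; 1ℚ; ½; ∣_∣)
import Data.Rational.Properties as ℚP
open import Data.Rational.Solver using (module +-*-Solver)
open import Data.Sum.Base using (_⊎_; inj₁; inj₂)
open import Data.Vec.Functional as Vector using (Vector)
import Data.Vec.Functional.Properties as VectorP
open import Function.Base using (_∘_; id)
open import Function.Definitions using (Injective)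
open import Level using (0ℓ)
open import Relation.Binary.Bundles using (Setoid)
open import Relation.Binary.Construct.Closure.ReflexiveTransitive using (Star)
open import Relation.Binary.Definitions using (Decidable)
open import Relation.Binary.PropositionalEquality as ≡ using (_≡_; _≢_; _≗_)
import Relation.Binary.Reasoning.Setoid as SetoidReasoning
open import Relation.Nullary using (¬_; Dec; yes; no; contradiction)
open import Relation.Nullary.Decidable using (_⊎-dec_; _×-dec_)

-- Real and complex numbers

-- Reals are Cauchy sequences here: equality with 0 cannot be decided, and a weight that is merely
-- not 0 comes without an inverse. So the expansion of a determinant is pruned by incidence, which
-- is decidable, rather than by the vanishing of entries, and the one division, in the proof of
-- independence, becomes a cancellation law obtained from `normSq`. Entries are given through their
-- squares, and a determinant carries the sign of a permutation. Both suggest comparing fourth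
-- powers of moduli: `normSq (d *ᶜ d)` equals `normSq` of the product of the weights. A single
-- square root, taken at the very end, turns this into the squared modulus of the minor d.

module _ where
  open Rat
  open ℚP
  open +-*-Solver

  p-0≡p : ∀ p → p - 0ℚ ≡ p
  p-0≡p = solve 1 (λ p → p :- con 0ℚ := p) ≡.refl

  p<p+ε : ∀ p {ε} → 0ℚ < ε → p < p + ε
  p<p+ε p {ε} ε>0 = ≡.subst (_< p + ε) (+-identityʳ p) (+-monoʳ-< p ε>0)

  ∣p-q∣≡∣q-p∣ : ∀ p q → ∣ p - q ∣ ≡ ∣ q - p ∣
  ∣p-q∣≡∣q-p∣ p q = ≡.trans (≡.sym (∣-p∣≡∣p∣ (p - q)))
    (≡.cong ∣_∣ (solve 2 (λ p q → :- (p :- q) := q :- p) ≡.refl p q))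

  square-cancel-≤ : ∀ {p q} → 0ℚ ≤ q → p * p ≤ q * q → p ≤ q
  square-cancel-≤ {p} {q} 0≤q p²≤q² = ≮⇒≥ λ q<p → <⇒≱
    (≤-<-trans (*-monoʳ-≤-nonNeg q {{nonNegative 0≤q}} (<⇒≤ q<p))
               (*-monoʳ-<-pos p {{positive (≤-<-trans 0≤q q<p)}} q<p)) p²≤q²

  square-cancel-< : ∀ {p q} → 0ℚ ≤ q → p * p < q * q → p < q
  square-cancel-< 0≤q p²<q² = ≰⇒> λ q≤p → <⇒≱ p²<q² (square-mono-≤ 0≤q q≤p)

  ∣p∣*∣p∣≡p*p : ∀ p → ∣ p ∣ * ∣ p ∣ ≡ p * p
  ∣p∣*∣p∣≡p*p p with ∣p∣≡p∨∣p∣≡-p p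
  ... | inj₁ eq = ≡.cong₂ _*_ eq eq
  ... | inj₂ eq = ≡.trans (≡.cong₂ _*_ eq eq) (solve 1 (λ p → :- p :* :- p := p :* p) ≡.refl p)

  0≤p*p : ∀ p → 0ℚ ≤ p * p
  0≤p*p p = ≡.subst (0ℚ ≤_) (∣p∣*∣p∣≡p*p p) (square-mono-≤ ≤-refl (0≤∣p∣ p))

Eventually : (ℕ → Set) → Set
Eventually P = ∃[ N ] (∀ n → N ℕ.≤ n → P n)

always : ∀ {P} → (∀ n → P n) → Eventually P
always p = 0 , λ n _ → p n

mapᵉ : ∀ {P Q : ℕ → Set} → (∀ n → P n → Q n) → Eventually P → Eventually Q
mapᵉ f (N , p) = N , λ n ≤n → f n (p n ≤n)

zipᵉ : ∀ {P Q : ℕ → Set} → Eventually P → Eventually Q → Eventually (λ n → P n × Q n)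
zipᵉ (M , p) (N , q) = M ℕ.⊔ N , λ n ≤n →
  p n (ℕP.m⊔n≤o⇒m≤o M N ≤n) , q n (ℕP.m⊔n≤o⇒n≤o M N ≤n)

module _ where
  open Rat
  open ℚP
  open +-*-Solver
  open _≈ᵣ_

  pointwise : ∀ {x y} → (∀ n → approx x n ≡ approx y n) → x ≈ᵣ y
  pointwise {x} {y} eq .close ε ε>0 = always λ n →
    ≡.subst (λ d → ∣ d ∣ < ε)
      (≡.sym (≡.trans (≡.cong (_- approx y n) (eq n)) (+-inverseʳ (approx y n)))) ε>0

  ≈ᵣ-setoid : Setoid 0ℓ 0ℓ
  ≈ᵣ-setoid = record
    { Carrier = ℝ
    ; _≈_ = _≈ᵣ_
    ; isEquivalence = record
      { refl  = pointwise λ _ → ≡.refl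
      ; sym   = λ {x} {y} x≈y → mk≈ λ ε ε>0 → mapᵉ
          (λ n → ≡.subst (_< ε) (∣p-q∣≡∣q-p∣ (approx x n) (approx y n))) (close x≈y ε ε>0)
      ; trans = λ {x} {y} {z} x≈y y≈z → mk≈ λ ε ε>0 → mapᵉ
          (λ { n (h , k) → begin-strict
            ∣ approx x n - approx z n ∣
              ≡⟨ ≡.cong ∣_∣ (solve 3 (λ a b c → a :- c := (a :- b) :+ (b :- c))
                   ≡.refl (approx x n) (approx y n) (approx z n)) ⟩
            ∣ (approx x n - approx y n) + (approx y n - approx z n) ∣
              ≤⟨ ∣p+q∣≤∣p∣+∣q∣ (approx x n - approx y n) (approx y n - approx z n) ⟩
            ∣ approx x n - approx y n ∣ + ∣ approx y n - approx z n ∣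
              <⟨ +-mono-< h k ⟩
            ½ * ε + ½ * ε
              ≡⟨ ½*p+½*p≡p ε ⟩
            ε ∎ })
          (zipᵉ (close x≈y (½ * ε) (½*p>0 ε>0)) (close y≈z (½ * ε) (½*p>0 ε>0)))
      }
    }
    where open ≤-Reasoning

  open Setoid ≈ᵣ-setoid public using () renaming (refl to ≈ᵣ-refl; sym to ≈ᵣ-sym; trans to ≈ᵣ-trans)

  -ᵣ-cong : ∀ {x y} → x ≈ᵣ y → -ᵣ x ≈ᵣ -ᵣ y
  -ᵣ-cong {x} {y} x≈y .close ε ε>0 = mapᵉ
    (λ n → ≡.subst (_< ε) (≡.trans (∣p-q∣≡∣q-p∣ (approx x n) (approx y n))
      (≡.cong ∣_∣ (solve 2 (λ a b → b :- a := :- a :- :- b) ≡.refl (approx x n) (approx y n)))))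
    (close x≈y ε ε>0)

  +ᵣ-cong : ∀ {x x′ y y′} → x ≈ᵣ x′ → y ≈ᵣ y′ → x +ᵣ y ≈ᵣ x′ +ᵣ y′
  +ᵣ-cong {x} {x′} {y} {y′} x≈x′ y≈y′ .close ε ε>0 = mapᵉ
    (λ { n (h , k) → begin-strict
      ∣ approx x n + approx y n - (approx x′ n + approx y′ n) ∣
        ≡⟨ ≡.cong ∣_∣ (solve 4 (λ a a′ b b′ → a :+ b :- (a′ :+ b′) := (a :- a′) :+ (b :- b′))
             ≡.refl (approx x n) (approx x′ n) (approx y n) (approx y′ n)) ⟩
      ∣ (approx x n - approx x′ n) + (approx y n - approx y′ n) ∣
        ≤⟨ ∣p+q∣≤∣p∣+∣q∣ (approx x n - approx x′ n) (approx y n - approx y′ n) ⟩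
      ∣ approx x n - approx x′ n ∣ + ∣ approx y n - approx y′ n ∣
        <⟨ +-mono-< h k ⟩
      ½ * ε + ½ * ε
        ≡⟨ ½*p+½*p≡p ε ⟩
      ε ∎ })
    (zipᵉ (close x≈x′ (½ * ε) (½*p>0 ε>0)) (close y≈y′ (½ * ε) (½*p>0 ε>0)))
    where open ≤-Reasoning

  *ᵣ-cong : ∀ {x x′ y y′} → x ≈ᵣ x′ → y ≈ᵣ y′ → x *ᵣ y ≈ᵣ x′ *ᵣ y′
  *ᵣ-cong {x} {x′} {y} {y′} x≈x′ y≈y′ .close ε ε>0 =
    let B , B>0 , hB  = eventually-bounded (cauchy x)
        C , C>0 , hC  = eventually-bounded (cauchy y′)
        i , i>0 , inv = positive-inverse (B + C) (+-mono-< B>0 C>0)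
        ε*i>0         = *-pos ε>0 i>0
    in mapᵉ
      (λ { n ((x≤B , y′≤C) , (h , k)) →
        product-estimate (approx x n) (approx y n) (approx x′ n) (approx y′ n)
          B>0 C>0 inv x≤B y′≤C h k })
      (zipᵉ (zipᵉ hB hC) (zipᵉ (close x≈x′ (ε * i) ε*i>0) (close y≈y′ (ε * i) ε*i>0)))

  -- Serves both square root laws: `√≈-lower` and `√≈-upper` trap a sequence termwise between an
  -- expression in `√ᵣ` and the same expression with an infinitesimal added to the root.
  squeeze : ∀ {x y z} → x ≈ᵣ z → (∀ n → approx x n ≤ approx y n) →
            (∀ n → approx y n ≤ approx z n) → x ≈ᵣ y
  squeeze {x} {y} {z} x≈z x≤y y≤z .close ε ε>0 = mapᵉ
    (λ n h → ∣p-q∣<r (≤-<-trans (x≤y n) (p<p+ε (approx y n) ε>0))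
      (≤-<-trans (y≤z n) (∣p-q∣<r⇒p<q+r
        (≡.subst (_< ε) (∣p-q∣≡∣q-p∣ (approx x n) (approx z n)) h))))
    (close x≈z ε ε>0)

  -- A representative of 0 whose terms are the precisions with which `√≈` computes.
  infinitesimal : ℝ
  infinitesimal = mkℝ 1/1+ λ ε ε>0 →
    let N , 1/N≤½ε = 1/1+-archimedean (½*p>0 ε>0)
        small : ∀ m → N ℕ.≤ m → ∀ n → 1/1+ m < 1/1+ n + ε
        small m N≤m n = begin-strict
          1/1+ m          ≤⟨ ≤-trans (1/1+-antimono N≤m) 1/N≤½ε ⟩
          ½ * ε           <⟨ p<p+ε (½ * ε) (½*p>0 ε>0) ⟩
          ½ * ε + ½ * ε   ≡⟨ ½*p+½*p≡p ε ⟩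
          ε               ≡⟨ +-identityˡ ε ⟨
          0ℚ + ε          <⟨ +-monoˡ-< ε (1/1+>0 n) ⟩
          1/1+ n + ε      ∎
    in N , λ m n N≤m N≤n → ∣p-q∣<r (small m N≤m n) (small n N≤n m)
    where open ≤-Reasoning

  x≈x+infinitesimal : ∀ x → x ≈ᵣ x +ᵣ infinitesimal
  x≈x+infinitesimal x .close ε ε>0 =
    let N , 1/N≤½ε = 1/1+-archimedean (½*p>0 ε>0)
    in N , λ n N≤n → ∣p-q∣<r
      (<-trans (p<p+ε (approx x n) (1/1+>0 n)) (p<p+ε (approx x n + 1/1+ n) ε>0))
      (+-monoʳ-< (approx x n) (≤-<-trans (≤-trans (1/1+-antimono N≤n) 1/N≤½ε)
        (≡.subst (½ * ε <_) (½*p+½*p≡p ε) (p<p+ε (½ * ε) (½*p>0 ε>0)))))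

  √ᵣ-cong : ∀ {x y} → x ≈ᵣ y → √ᵣ x ≈ᵣ √ᵣ y
  √ᵣ-cong {x} {y} x≈y .close ε ε>0 =
    -- `√≈-close` turns a distance δ² between radicands into 2δ between roots.
    let δ = ½ * ε
        δ>0 = ½*p>0 ε>0
        N , 1/N≤δ = 1/1+-archimedean δ>0
        close-at : ∀ n → N ℕ.≤ n → ∀ {p q} → p < q + δ * δ → √≈ n p < √≈ n q + ε
        close-at n N≤n {p} {q} h = ≡.subst (λ e → √≈ n p < √≈ n q + e) (½*p+½*p≡p ε)
          (√≈-close n n δ>0 (≤-trans (1/1+-antimono N≤n) 1/N≤δ) h)
    in mapᵉ
      (λ { n (N≤n , h) → ∣p-q∣<r (close-at n N≤n (∣p-q∣<r⇒p<q+r h))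
        (close-at n N≤n (∣p-q∣<r⇒p<q+r
          (≡.subst (_< δ * δ) (∣p-q∣≡∣q-p∣ (approx x n) (approx y n)) h))) })
      (zipᵉ (N , λ _ N≤n → N≤n) (close x≈y (δ * δ) (*-pos δ>0 δ>0)))

  -- Termwise nonnegativity, which squared moduli satisfy, settles the case where `√≈` is at its
  -- starting value 0; otherwise squares are compared.
  √ᵣ[x*x]≈x : ∀ {x} → (∀ n → 0ℚ ≤ approx x n) → √ᵣ (x *ᵣ x) ≈ᵣ x
  √ᵣ[x*x]≈x {x} 0≤x = squeeze (x≈x+infinitesimal (√ᵣ (x *ᵣ x)))
    (λ n → below n (√≈-lower n (approx x n * approx x n)))
    (λ n → <⇒≤ (square-cancel-<
      (+-mono-≤ (√≈-nonneg n (approx x n * approx x n)) (<⇒≤ (1/1+>0 n)))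
      (√≈-upper n (approx x n * approx x n))))
    where
    below : ∀ n {r} → r ≡ 0ℚ ⊎ r * r ≤ approx x n * approx x n → r ≤ approx x n
    below n (inj₁ ≡.refl) = 0≤x n
    below n (inj₂ r²≤x²)  = square-cancel-≤ (0≤x n) r²≤x²

  √ᵣx*√ᵣx≈x : ∀ {x} → (∀ n → 0ℚ ≤ approx x n) → √ᵣ x *ᵣ √ᵣ x ≈ᵣ x
  √ᵣx*√ᵣx≈x {x} 0≤x = squeeze
    (*ᵣ-cong (x≈x+infinitesimal (√ᵣ x)) (x≈x+infinitesimal (√ᵣ x)))
    (λ n → below n (√≈-lower n (approx x n)))
    (λ n → <⇒≤ (√≈-upper n (approx x n)))
    where
    below : ∀ n {r} → r ≡ 0ℚ ⊎ r * r ≤ approx x n → r * r ≤ approx x n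
    below n (inj₁ ≡.refl) = 0≤x n
    below n (inj₂ r²≤x)   = r²≤x

  -- Apartness from 0 is decided on an approximation: at precision ε, either x is
  -- small or x is bounded away from 0, and then x * y ≈ 0 forces y ≈ 0.
  *ᵣ-cancelʳ-0 : ∀ {x y} → x *ᵣ y ≈ᵣ 0ᵣ → ¬ (y ≈ᵣ 0ᵣ) → x ≈ᵣ 0ᵣ
  *ᵣ-cancelʳ-0 {x} {y} xy≈0 y≉0 .close ε ε>0 = decide (cauchy x δ δ>0)
    where
    open ≤-Reasoning
    δ : ℚ
    -- A quarter of ε: if term `N` is at least ε/2 in absolute value and later terms differ from it
    -- by less than ε/4, these stay above ε/4.
    δ = ½ * (½ * ε)
    δ>0 : 0ℚ < δ
    δ>0 = ½*p>0 (½*p>0 ε>0)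
    δ<½ε : δ < ½ * ε
    δ<½ε = ≡.subst (δ <_) (½*p+½*p≡p (½ * ε)) (p<p+ε δ δ>0)

    y-small : ∀ {n} η → 0ℚ < η → δ < ∣ approx x n ∣ →
              ∣ approx x n * approx y n - 0ℚ ∣ < δ * η → ∣ approx y n - 0ℚ ∣ < η
    y-small {n} η η>0 δ<x xy<δη = ≰⇒> λ η≤y → <⇒≱ xy<δη (begin
      δ * η
        ≤⟨ *-monoʳ-≤-nonNeg η {{nonNegative (<⇒≤ η>0)}} (<⇒≤ δ<x) ⟩
      ∣ approx x n ∣ * η
        ≤⟨ *-monoˡ-≤-nonNeg ∣ approx x n ∣ {{∣-∣-nonNeg (approx x n)}} η≤y ⟩
      ∣ approx x n ∣ * ∣ approx y n - 0ℚ ∣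
        ≡⟨ ∣p*q∣≡∣p∣*∣q∣ (approx x n) (approx y n - 0ℚ) ⟨
      ∣ approx x n * (approx y n - 0ℚ) ∣
        ≡⟨ ≡.cong ∣_∣ (solve 2 (λ a b → a :* (b :- con 0ℚ) := a :* b :- con 0ℚ)
             ≡.refl (approx x n) (approx y n)) ⟩
      ∣ approx x n * approx y n - 0ℚ ∣ ∎)

    ∣p∣≤∣p-q∣+∣q∣ : ∀ p q → ∣ p ∣ ≤ ∣ p - q ∣ + ∣ q ∣
    ∣p∣≤∣p-q∣+∣q∣ p q = ≡.subst (_≤ ∣ p - q ∣ + ∣ q ∣)
      (≡.cong ∣_∣ (solve 2 (λ p q → (p :- q) :+ q := p) ≡.refl p q)) (∣p+q∣≤∣p∣+∣q∣ (p - q) q)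

    decide : ∃[ N ] (∀ m n → N ℕ.≤ m → N ℕ.≤ n → ∣ approx x m - approx x n ∣ < δ) →
             Eventually (λ n → ∣ approx x n - 0ℚ ∣ < ε)
    decide (N , hx) with ∣ approx x N ∣ <? ½ * ε
    ... | yes small = N , λ n N≤n → begin-strict
      ∣ approx x n - 0ℚ ∣
        ≡⟨ ≡.cong ∣_∣ (p-0≡p (approx x n)) ⟩
      ∣ approx x n ∣
        ≤⟨ ∣p∣≤∣p-q∣+∣q∣ (approx x n) (approx x N) ⟩
      ∣ approx x n - approx x N ∣ + ∣ approx x N ∣
        <⟨ +-mono-< (<-trans (hx n N N≤n ℕP.≤-refl) δ<½ε) small ⟩
      ½ * ε + ½ * ε
        ≡⟨ ½*p+½*p≡p ε ⟩
      ε ∎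
    ... | no large = contradiction
      (mk≈ λ η η>0 → mapᵉ (λ { n (N≤n , h) → y-small η η>0 (away n N≤n) h })
        (zipᵉ (N , λ _ N≤n → N≤n) (close xy≈0 (δ * η) (*-pos δ>0 η>0)))) y≉0
      where
      away : ∀ n → N ℕ.≤ n → δ < ∣ approx x n ∣
      away n N≤n = ≰⇒> λ x≤δ → large (begin-strict
        ∣ approx x N ∣
          ≤⟨ ∣p∣≤∣p-q∣+∣q∣ (approx x N) (approx x n) ⟩
        ∣ approx x N - approx x n ∣ + ∣ approx x n ∣
          <⟨ +-mono-<-≤ (hx N n ℕP.≤-refl N≤n) x≤δ ⟩
        δ + δ
          ≡⟨ ½*p+½*p≡p (½ * ε) ⟩
        ½ * ε ∎)

  -- The square of `y` only adds, so a sum of squares below ε² leaves `x` below ε in absolute value.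
  x*x+y*y≈0⇒x≈0 : ∀ {x y} → x *ᵣ x +ᵣ y *ᵣ y ≈ᵣ 0ᵣ → x ≈ᵣ 0ᵣ
  x*x+y*y≈0⇒x≈0 {x} {y} h .close ε ε>0 = mapᵉ
    (λ n k → ≡.subst (_< ε) (≡.cong ∣_∣ (≡.sym (p-0≡p (approx x n))))
      (square-cancel-< (<⇒≤ ε>0) (begin-strict
        ∣ approx x n ∣ * ∣ approx x n ∣
          ≡⟨ ∣p∣*∣p∣≡p*p (approx x n) ⟩
        approx x n * approx x n
          ≡⟨ +-identityʳ (approx x n * approx x n) ⟨
        approx x n * approx x n + 0ℚ
          ≤⟨ +-monoʳ-≤ (approx x n * approx x n) (0≤p*p (approx y n)) ⟩
        approx x n * approx x n + approx y n * approx y n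
          ≤⟨ p≤∣p∣ (approx x n * approx x n + approx y n * approx y n) ⟩
        ∣ approx x n * approx x n + approx y n * approx y n ∣
          ≡⟨ ≡.cong ∣_∣ (p-0≡p (approx x n * approx x n + approx y n * approx y n)) ⟨
        ∣ approx x n * approx x n + approx y n * approx y n - 0ℚ ∣
          <⟨ k ⟩
        ε * ε ∎)))
    (close h (ε * ε) (*-pos ε>0 ε>0))
    where open ≤-Reasoning

  -- Complex arithmetic and the squared modulus

  pointwiseᶜ : ∀ {z w} → (∀ n → approx (re z) n ≡ approx (re w) n) →
               (∀ n → approx (im z) n ≡ approx (im w) n) → z ≈ᶜ w
  pointwiseᶜ eq₁ eq₂ = mk≈ᶜ (pointwise eq₁) (pointwise eq₂)

  -- The ring identities hold exactly between rational approximations, term by term; only the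
  -- congruences rest on estimates.
  ℂ-commutativeRing : CommutativeRing 0ℓ 0ℓ
  ℂ-commutativeRing = record
    { Carrier = ℂ ; _≈_ = _≈ᶜ_ ; _+_ = _+ᶜ_ ; _*_ = _*ᶜ_ ; -_ = -ᶜ_ ; 0# = 0ᶜ ; 1# = 1ᶜ
    ; isCommutativeRing = record
      { isRing = record
        { +-isAbelianGroup = record
          { isGroup = record
            { isMonoid = record
              { isSemigroup = record
                { isMagma = record
                  { isEquivalence = record
                    { refl  = mk≈ᶜ ≈ᵣ-refl ≈ᵣ-refl
                    ; sym   = λ { (mk≈ᶜ r i) → mk≈ᶜ (≈ᵣ-sym r) (≈ᵣ-sym i) }
                    ; trans = λ { (mk≈ᶜ r i) (mk≈ᶜ r′ i′) → mk≈ᶜ (≈ᵣ-trans r r′) (≈ᵣ-trans i i′) }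
                    }
                  ; ∙-cong = λ { (mk≈ᶜ r i) (mk≈ᶜ r′ i′) → mk≈ᶜ (+ᵣ-cong r r′) (+ᵣ-cong i i′) }
                  }
                ; assoc = λ z w v → pointwiseᶜ
                    (λ n → +-assoc (approx (re z) n) (approx (re w) n) (approx (re v) n))
                    (λ n → +-assoc (approx (im z) n) (approx (im w) n) (approx (im v) n))
                }
              ; identity = (λ z → pointwiseᶜ (λ n → +-identityˡ _) (λ n → +-identityˡ _))
                         , (λ z → pointwiseᶜ (λ n → +-identityʳ _) (λ n → +-identityʳ _))
              }
            ; inverse =
                (λ z → pointwiseᶜ (λ n → +-inverseˡ (approx (re z) n))
                                  (λ n → +-inverseˡ (approx (im z) n)))
              , (λ z → pointwiseᶜ (λ n → +-inverseʳ (approx (re z) n))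
                                  (λ n → +-inverseʳ (approx (im z) n)))
            ; ⁻¹-cong = λ { (mk≈ᶜ r i) → mk≈ᶜ (-ᵣ-cong r) (-ᵣ-cong i) }
            }
          ; comm = λ z w → pointwiseᶜ (λ n → +-comm (approx (re z) n) (approx (re w) n))
                                      (λ n → +-comm (approx (im z) n) (approx (im w) n))
          }
        ; *-cong = λ { (mk≈ᶜ r i) (mk≈ᶜ r′ i′) → mk≈ᶜ
            (+ᵣ-cong (*ᵣ-cong r r′) (-ᵣ-cong (*ᵣ-cong i i′)))
            (+ᵣ-cong (*ᵣ-cong r i′) (*ᵣ-cong i r′)) }
        ; *-assoc = λ z w v → pointwiseᶜ
            (λ n → solve 6 (λ a b c d e f →
                (a :* c :+ :- (b :* d)) :* e :+ :- ((a :* d :+ b :* c) :* f)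
              := a :* (c :* e :+ :- (d :* f)) :+ :- (b :* (c :* f :+ d :* e))) ≡.refl
              (approx (re z) n) (approx (im z) n) (approx (re w) n) (approx (im w) n)
              (approx (re v) n) (approx (im v) n))
            (λ n → solve 6 (λ a b c d e f →
                (a :* c :+ :- (b :* d)) :* f :+ (a :* d :+ b :* c) :* e
              := a :* (c :* f :+ d :* e) :+ b :* (c :* e :+ :- (d :* f))) ≡.refl
              (approx (re z) n) (approx (im z) n) (approx (re w) n) (approx (im w) n)
              (approx (re v) n) (approx (im v) n))
        ; *-identity =
            (λ z → pointwiseᶜ
              (λ n → solve 2 (λ a b → con 1ℚ :* a :+ :- (con 0ℚ :* b) := a) ≡.refl
                (approx (re z) n) (approx (im z) n))
              (λ n → solve 2 (λ a b → con 1ℚ :* b :+ con 0ℚ :* a := b) ≡.refl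
                (approx (re z) n) (approx (im z) n)))
          , (λ z → pointwiseᶜ
              (λ n → solve 2 (λ a b → a :* con 1ℚ :+ :- (b :* con 0ℚ) := a) ≡.refl
                (approx (re z) n) (approx (im z) n))
              (λ n → solve 2 (λ a b → a :* con 0ℚ :+ b :* con 1ℚ := b) ≡.refl
                (approx (re z) n) (approx (im z) n)))
        ; distrib =
            (λ z w v → pointwiseᶜ
              (λ n → solve 6 (λ a b c d e f →
                  a :* (c :+ e) :+ :- (b :* (d :+ f))
                := (a :* c :+ :- (b :* d)) :+ (a :* e :+ :- (b :* f))) ≡.refl
                (approx (re z) n) (approx (im z) n) (approx (re w) n) (approx (im w) n)
                (approx (re v) n) (approx (im v) n))
              (λ n → solve 6 (λ a b c d e f →
                  a :* (d :+ f) :+ b :* (c :+ e)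
                := (a :* d :+ b :* c) :+ (a :* f :+ b :* e)) ≡.refl
                (approx (re z) n) (approx (im z) n) (approx (re w) n) (approx (im w) n)
                (approx (re v) n) (approx (im v) n)))
          , (λ z w v → pointwiseᶜ
              (λ n → solve 6 (λ a b c d e f →
                  (c :+ e) :* a :+ :- ((d :+ f) :* b)
                := (c :* a :+ :- (d :* b)) :+ (e :* a :+ :- (f :* b))) ≡.refl
                (approx (re z) n) (approx (im z) n) (approx (re w) n) (approx (im w) n)
                (approx (re v) n) (approx (im v) n))
              (λ n → solve 6 (λ a b c d e f →
                  (c :+ e) :* b :+ (d :+ f) :* a
                := (c :* b :+ d :* a) :+ (e :* b :+ f :* a)) ≡.refl
                (approx (re z) n) (approx (im z) n) (approx (re w) n) (approx (im w) n)
                (approx (re v) n) (approx (im v) n)))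
        }
      ; *-comm = λ z w → pointwiseᶜ
          (λ n → solve 4 (λ a b c d → a :* c :+ :- (b :* d) := c :* a :+ :- (d :* b)) ≡.refl
            (approx (re z) n) (approx (im z) n) (approx (re w) n) (approx (im w) n))
          (λ n → solve 4 (λ a b c d → a :* d :+ b :* c := c :* b :+ d :* a) ≡.refl
            (approx (re z) n) (approx (im z) n) (approx (re w) n) (approx (im w) n))
      }
    }

  -- Being free of roots, it is multiplicative by a polynomial identity.
  normSq : ℂ → ℝ
  normSq z = re z *ᵣ re z +ᵣ im z *ᵣ im z

  normSq-nonneg : ∀ z n → 0ℚ ≤ approx (normSq z) n
  normSq-nonneg z n = +-mono-≤ (0≤p*p (approx (re z) n)) (0≤p*p (approx (im z) n))

  normSq-cong : ∀ {z w} → z ≈ᶜ w → normSq z ≈ᵣ normSq w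
  normSq-cong (mk≈ᶜ r i) = +ᵣ-cong (*ᵣ-cong r r) (*ᵣ-cong i i)

  normSq-* : ∀ z w → normSq (z *ᶜ w) ≈ᵣ normSq z *ᵣ normSq w
  normSq-* z w = pointwise λ n → solve 4 (λ a b c d →
      (a :* c :+ :- (b :* d)) :* (a :* c :+ :- (b :* d)) :+ (a :* d :+ b :* c) :* (a :* d :+ b :* c)
    := (a :* a :+ b :* b) :* (c :* c :+ d :* d)) ≡.refl
    (approx (re z) n) (approx (im z) n) (approx (re w) n) (approx (im w) n)

  normSq-conj : ∀ z → normSq (conj z) ≈ᵣ normSq z
  normSq-conj z = pointwise λ n →
    solve 2 (λ a b → a :* a :+ :- b :* :- b := a :* a :+ b :* b) ≡.refl
      (approx (re z) n) (approx (im z) n)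

  normSq-0 : normSq 0ᶜ ≈ᵣ 0ᵣ
  normSq-0 = pointwise λ n → ≡.refl

normSq≈0⇒≈0 : ∀ {z} → normSq z ≈ᵣ 0ᵣ → z ≈ᶜ 0ᶜ
normSq≈0⇒≈0 {z} h = mk≈ᶜ (x*x+y*y≈0⇒x≈0 h)
  (x*x+y*y≈0⇒x≈0 {im z} {re z} (≈ᵣ-trans (pointwise λ n →
    ℚP.+-comm (approx (im z *ᵣ im z) n) (approx (re z *ᵣ re z) n)) h))

-- Dividing by `w` would take a positive lower bound for its modulus; multiplicativity of `normSq`
-- passes the question to real cancellation instead.
*ᶜ-cancelʳ-0 : ∀ {z w} → z *ᶜ w ≈ᶜ 0ᶜ → ¬ (w ≈ᶜ 0ᶜ) → z ≈ᶜ 0ᶜ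
*ᶜ-cancelʳ-0 {z} {w} zw≈0 w≉0 = normSq≈0⇒≈0 (*ᵣ-cancelʳ-0
  (≈ᵣ-trans (≈ᵣ-sym (normSq-* z w)) (≈ᵣ-trans (normSq-cong zw≈0) normSq-0))
  (λ h → w≉0 (normSq≈0⇒≈0 h)))

∣z∣*∣z∣≈normSq : ∀ z → ∣ z ∣ᶜ *ᵣ ∣ z ∣ᶜ ≈ᵣ normSq z
∣z∣*∣z∣≈normSq z = √ᵣx*√ᵣx≈x (normSq-nonneg z)

-- The hypothesis concerns `z *ᶜ z` because the square of a minor is what the expansion delivers.
normSq²⇒∣∣ : ∀ {z w} → normSq (z *ᶜ z) ≈ᵣ normSq w → ∣ z ∣ᶜ *ᵣ ∣ z ∣ᶜ ≈ᵣ ∣ w ∣ᶜ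
normSq²⇒∣∣ {z} {w} h = begin
  ∣ z ∣ᶜ *ᵣ ∣ z ∣ᶜ             ≈⟨ ∣z∣*∣z∣≈normSq z ⟩
  normSq z                     ≈⟨ √ᵣ[x*x]≈x (normSq-nonneg z) ⟨
  √ᵣ (normSq z *ᵣ normSq z)    ≈⟨ √ᵣ-cong (normSq-* z z) ⟨
  √ᵣ (normSq (z *ᶜ z))         ≈⟨ √ᵣ-cong h ⟩
  ∣ w ∣ᶜ                       ∎
  where open SetoidReasoning ≈ᵣ-setoid

normSq-product : ∀ {n} {f g : Vector ℂ n} → (∀ i → normSq (f i) ≈ᵣ normSq (g i)) →
                 normSq (productᶜ f) ≈ᵣ normSq (productᶜ g)
normSq-product {zero}  h = ≈ᵣ-refl
normSq-product {suc n} {f} {g} h = ≈ᵣ-trans (normSq-* (f zero) _)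
  (≈ᵣ-trans (*ᵣ-cong (h zero) (normSq-product λ i → h (suc i))) (≈ᵣ-sym (normSq-* (g zero) _)))

-- Determinants

-- A perfect matching of rows with columns along `S`, since an injective self-map of `Fin n` is a
-- permutation.
record IsTransversal {n} (S : Fin n → Fin n → Set) (σ : Fin n → Fin n) : Set where
  field
    injective : Injective _≡_ _≡_ σ
    supported : ∀ i → S i (σ i)

module _ {n} {S : Fin (suc n) → Fin (suc n) → Set} where
  open IsTransversal

  minorSupport : Fin (suc n) → Fin n → Fin n → Set
  minorSupport j i k = S (suc i) (punchIn j k)

  -- Together with `shrink`, this matches the transversals through position (`zero`, `j`) with those
  -- of the minor, so that cofactor expansion becomes a recursion on transversals.
  extend : ∀ {j σ} → S zero j → IsTransversal (minorSupport j) σ →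
           IsTransversal S (j Vector.∷ (punchIn j ∘ σ))
  extend {j} {σ} s t .injective {zero} {zero} _ = ≡.refl
  extend {j} {σ} s t .injective {zero} {suc k} eq =
    contradiction (≡.sym eq) (FinP.punchInᵢ≢i j (σ k))
  extend {j} {σ} s t .injective {suc i} {zero} eq =
    contradiction eq (FinP.punchInᵢ≢i j (σ i))
  extend {j} {σ} s t .injective {suc i} {suc k} eq =
    ≡.cong suc (injective t (FinP.punchIn-injective j (σ i) (σ k) eq))
  extend s t .supported zero    = s
  extend s t .supported (suc i) = supported t i

  module _ {σ} (t : IsTransversal S σ) where
    head≢tail : ∀ i → σ zero ≢ σ (suc i)
    head≢tail i eq with injective t eq
    ... | ()

    shrink : Fin n → Fin n
    shrink i = punchOut (head≢tail i)

    punchIn-shrink : ∀ i → punchIn (σ zero) (shrink i) ≡ σ (suc i)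
    punchIn-shrink i = FinP.punchIn-punchOut (head≢tail i)

    shrink-transversal : IsTransversal (minorSupport (σ zero)) shrink
    shrink-transversal .injective {i} {k} eq = FinP.suc-injective
      (injective t (FinP.punchOut-injective (head≢tail i) (head≢tail k) eq))
    shrink-transversal .supported i =
      ≡.subst (S (suc i)) (≡.sym (punchIn-shrink i)) (supported t (suc i))

module Determinants {c ℓ} (R : CommutativeRing c ℓ) where
  open CommutativeRing R hiding (zero)
  open RawSemiringDefinitions (RawRing.rawSemiring rawRing) using (_^_; product)
  open RingProperties ring using (-1*x≈-x; -‿involutive)
  open CommutativeSemigroupProperties *-commutativeSemigroup using (interchange)
  open SemiringSum semiring using (sum; sum-cong-≋; sum-replicate-zero; sum-remove)
  open SetoidReasoning setoid
  private module L = LinearAlgebra rawRing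

  sum-zero : ∀ {n} (t : Vector Carrier n) → (∀ i → t i ≈ 0#) → sum t ≈ 0#
  sum-zero {n} t t≈0 = trans (sum-cong-≋ t≈0) (sum-replicate-zero n)

  sum-single : ∀ {n} (t : Vector Carrier n) k → (∀ i → i ≢ k → t i ≈ 0#) → sum t ≈ t k
  sum-single {suc n} t k t≈0 = begin
    sum t                          ≈⟨ sum-remove {i = k} t ⟩
    t k + sum (t ∘ punchIn k)      ≈⟨ +-congˡ (sum-zero _ λ i → t≈0 _ (FinP.punchInᵢ≢i k i)) ⟩
    t k + 0#                       ≈⟨ +-identityʳ (t k) ⟩
    t k                            ∎

  det-cong : ∀ {n} {A B : L.Matrix n n} → (∀ i j → A i j ≈ B i j) → L.det A ≈ L.det B
  det-cong {zero}  A≈B = refl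
  det-cong {suc n} {A} {B} A≈B = sum-cong-≋ λ j →
    *-cong (*-congˡ {(- 1#) ^ toℕ j} (A≈B zero j)) (det-cong λ i k → A≈B (suc i) (punchIn j k))

  sign² : ∀ k → (- 1#) ^ k * (- 1#) ^ k ≈ 1#
  sign² zero    = *-identityˡ 1#
  sign² (suc k) = begin
    (- 1# * s) * (- 1# * s)    ≈⟨ interchange (- 1#) s (- 1#) s ⟩
    (- 1# * - 1#) * (s * s)    ≈⟨ *-cong (trans (-1*x≈-x (- 1#)) (-‿involutive 1#)) (sign² k) ⟩
    1# * 1#                    ≈⟨ *-identityˡ 1# ⟩
    1#                         ∎
    where
    s : Carrier
    s = (- 1#) ^ k

  -- `S` may be larger than the set of non-zero positions. This lets a decidable relation stand in
  -- for one that is not.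
  SupportedBy : ∀ {n} → L.Matrix n n → (Fin n → Fin n → Set) → Set ℓ
  SupportedBy A S = ∀ i j → ¬ S i j → A i j ≈ 0#

  -- Each cofactor term dies through its entry or through its minor, because a transversal of the
  -- minor below a supported entry would extend to the whole matrix.
  det-noTransversal : ∀ {n} {A : L.Matrix n n} {S} → Decidable S → SupportedBy A S →
                      (∀ σ → ¬ IsTransversal S σ) → L.det A ≈ 0#
  -- Stated for a single column, so that it also removes all but one term when there is exactly one
  -- transversal.
  cofactor-zero : ∀ {n} {A : L.Matrix (suc n) (suc n)} {S} → Decidable S → SupportedBy A S → ∀ j →
                  (S zero j → ∀ σ → ¬ IsTransversal (minorSupport {S = S} j) σ) →
                  (- 1#) ^ toℕ j * A zero j * L.det (L.submatrix suc (punchIn j) A) ≈ 0#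

  -- The empty map is a transversal of the empty matrix, whose determinant is 1.
  det-noTransversal {zero} dec sup none =
    contradiction (record { injective = λ {i} → contradiction i λ () ; supported = λ () })
                  (none λ ())
  det-noTransversal {suc n} dec sup none = sum-zero _ λ j →
    cofactor-zero dec sup j λ s σ t → none _ (extend s t)

  cofactor-zero dec sup j none with dec zero j
  ... | yes s = trans
    (*-congˡ (det-noTransversal (λ i k → dec (suc i) (punchIn j k))
                                (λ i k → sup (suc i) (punchIn j k)) (none s)))
    (zeroʳ _)
  ... | no ¬s = trans (*-congʳ (trans (*-congˡ (sup zero j ¬s)) (zeroʳ _))) (zeroˡ _)

  -- Squaring removes the sign of the permutation p.
  det²-uniqueTransversal : ∀ {n} {A : L.Matrix n n} {S p} → Decidable S → SupportedBy A S →
    IsTransversal S p → (∀ σ → IsTransversal S σ → σ ≗ p) →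
    L.det A * L.det A ≈ product λ i → A i (p i) * A i (p i)
  det²-uniqueTransversal {zero} dec sup t unique = *-identityˡ 1#
  det²-uniqueTransversal {suc n} {A} {S} {p} dec sup t unique = begin
    L.det A * L.det A
      ≈⟨ *-cong expand expand ⟩
    (s * a * d) * (s * a * d)
      ≈⟨ interchange (s * a) d (s * a) d ⟩
    ((s * a) * (s * a)) * (d * d)
      ≈⟨ *-cong (interchange s a s a) minor² ⟩
    ((s * s) * (a * a)) * product (λ i → A (suc i) (p (suc i)) * A (suc i) (p (suc i)))
      ≈⟨ *-congʳ (trans (*-congʳ (sign² (toℕ (p zero)))) (*-identityˡ (a * a))) ⟩
    (a * a) * product (λ i → A (suc i) (p (suc i)) * A (suc i) (p (suc i))) ∎
    where
    s a d : Carrier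
    s = (- 1#) ^ toℕ (p zero)
    a = A zero (p zero)
    d = L.det (L.submatrix suc (punchIn (p zero)) A)

    -- A transversal of the minor at another supported column `j` would extend to one that differs
    -- from `p` at `zero`.
    expand : L.det A ≈ s * a * d
    expand = sum-single _ (p zero) λ j j≢p0 → cofactor-zero dec sup j λ Sj σ t′ →
      j≢p0 (unique _ (extend Sj t′) zero)

    shrink-unique : ∀ σ → IsTransversal (minorSupport {S = S} (p zero)) σ → σ ≗ shrink t
    shrink-unique σ t′ i = FinP.punchIn-injective (p zero) _ _ (≡.trans
      (unique _ (extend (IsTransversal.supported t zero) t′) (suc i))
      (≡.sym (punchIn-shrink t i)))

    minor² : d * d ≈ product λ i → A (suc i) (p (suc i)) * A (suc i) (p (suc i))
    minor² = trans
      (det²-uniqueTransversal (λ i k → dec (suc i) (punchIn (p zero) k))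
        (λ i k → sup (suc i) (punchIn (p zero) k)) (shrink-transversal t) shrink-unique)
      (product-cong λ i → reflexive (≡.cong (λ j → A (suc i) j * A (suc i) j) (punchIn-shrink t i)))
      where
      product-cong : ∀ {m} {f g : Vector Carrier m} → (∀ i → f i ≈ g i) → product f ≈ product g
      product-cong {zero}  f≈g = refl
      product-cong {suc m} f≈g = *-cong (f≈g zero) (product-cong (f≈g ∘ suc))

  v∈Span : ∀ {n k} (v : Vector (Vector Carrier n) k) j → v j L.∈Span v
  v∈Span v j = unit , λ i → sym (begin
    L.combination unit v i   ≈⟨ sum-single _ j (λ k k≢j → trans (*-congʳ (unit-other k≢j)) (zeroˡ _)) ⟩
    unit j * v j i           ≈⟨ *-congʳ (reflexive (VectorP.updateAt-updates j zeros)) ⟩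
    1# * v j i               ≈⟨ *-identityˡ (v j i) ⟩
    v j i                    ∎)
    where
    zeros unit : Vector Carrier _
    zeros = Vector.replicate _ 0#
    unit  = Vector.updateAt zeros j λ _ → 1#

    unit-other : ∀ {k} → k ≢ j → unit k ≈ 0#
    unit-other {k} k≢j = reflexive (VectorP.updateAt-minimal k j zeros k≢j)

-- Trees

module Trees {n m} (T : OrientedTree n m) where
  open OrientedTree T
  open DecMembership (FinP._≟_ {n}) using (_∈?_)

  Joins : Fin m → Fin n → Fin n → Set
  Joins e u v = (src e ≡ u × tgt e ≡ v) ⊎ (src e ≡ v × tgt e ≡ u)

  Incident : Fin m → Fin n → Set
  Incident e v = src e ≡ v ⊎ tgt e ≡ v

  incident? : ∀ e v → Dec (Incident e v)
  incident? e v = (src e FinP.≟ v) ⊎-dec (tgt e FinP.≟ v)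

  adjacent-sym : ∀ {u v} → Adjacent u v → Adjacent v u
  adjacent-sym (e , inj₁ j) = e , inj₂ j
  adjacent-sym (e , inj₂ j) = e , inj₁ j

  -- Simple paths; the list consists of the vertices after the first one.
  data Path : Fin n → Fin n → List (Fin n) → Set where
    []   : ∀ {u} → Path u u []
    step : ∀ {u w v p} → Adjacent u w → Path w v p → u ∉ w ∷ p → Path u v (w ∷ p)

  snoc : ∀ {u w v p} → Path u w p → Adjacent w v → v ∉ u ∷ p → Path u v (p ++ v ∷ [])
  snoc [] a v∉ = step a [] λ { (here eq) → v∉ (here (≡.sym eq)) }
  snoc {u} {p = w′ ∷ p} (step b P u∉) a v∉ = step b (snoc P a (v∉ ∘ there)) u∉′
    where
    u∉′ : u ∉ w′ ∷ p ++ _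
    u∉′ u∈ with ∈-++⁻ (w′ ∷ p) u∈
    ... | inj₁ u∈p       = u∉ u∈p
    ... | inj₂ (here eq) = v∉ (here (≡.sym eq))

  path-injective : ∀ {u v p} → Path u v p → Injective _≡_ _≡_ (lookup (u ∷ p))
  path-injective P {zero} {zero} eq = ≡.refl
  path-injective (step a P u∉) {zero} {suc j} eq =
    contradiction (≡.subst (_∈ _) (≡.sym eq) (∈-lookup j)) u∉
  path-injective (step a P u∉) {suc i} {zero} eq =
    contradiction (≡.subst (_∈ _) eq (∈-lookup i)) u∉
  path-injective (step a P u∉) {suc i} {suc j} eq = ≡.cong suc (path-injective P eq)

  path-adjacent : ∀ {u v p} → Path u v p → ∀ (i : Fin (length p)) →
                  Adjacent (lookup (u ∷ p) (inject₁ i)) (lookup (u ∷ p) (suc i))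
  path-adjacent (step a P u∉) zero    = a
  path-adjacent (step a P u∉) (suc i) = path-adjacent P i

  path-last : ∀ {u v p} → Path u v p → lookup (u ∷ p) (fromℕ (length p)) ≡ v
  path-last []            = ≡.refl
  path-last (step a P u∉) = path-last P

  -- As `p` omits the first vertex, the bound means at least three vertices, the least cycle length
  -- in `acyclic`.
  no-cycle : ∀ {u v p} → Path u v p → 2 ℕ.≤ length p → ¬ Adjacent v u
  no-cycle {u} {p = w ∷ x ∷ p} P _ a = acyclic (length p) (lookup (u ∷ w ∷ x ∷ p)) (path-injective P)
    (path-adjacent P) (≡.subst (λ z → Adjacent z _) (≡.sym (path-last P)) a)
  no-cycle {p = _ ∷ []} P (ℕ.s≤s ())

  joins-unique : ∀ {e f u v} → Joins e u v → Joins f u v → f ≡ e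
  joins-unique {e} {f} (inj₁ (≡.refl , ≡.refl)) (inj₁ j) = simple f e (inj₁ j)
  joins-unique {e} {f} (inj₁ (≡.refl , ≡.refl)) (inj₂ j) = simple f e (inj₂ j)
  joins-unique {e} {f} (inj₂ (≡.refl , ≡.refl)) (inj₁ j) = simple f e (inj₂ j)
  joins-unique {e} {f} (inj₂ (≡.refl , ≡.refl)) (inj₂ j) = simple f e (inj₁ j)

  Within : List (Fin n) → Fin m → Set
  Within S e = src e ∈ S × tgt e ∈ S

  within? : ∀ S e → Dec (Within S e)
  within? S e = (src e ∈? S) ×-dec (tgt e ∈? S)

  within-incident : ∀ {S e v} → Within S e → Incident e v → v ∈ S
  within-incident (s , t) (inj₁ ≡.refl) = s
  within-incident (s , t) (inj₂ ≡.refl) = t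

  within-tail : ∀ {S e v} → Within (v ∷ S) e → ¬ Incident e v → Within S e
  within-tail (here eq , _)        ¬i = contradiction (inj₁ eq) ¬i
  within-tail (there _ , here eq)  ¬i = contradiction (inj₂ eq) ¬i
  within-tail (there s , there t)  ¬i = s , t

  within-⊆ : ∀ {S S′ e} → S ⊆ S′ → Within S e → Within S′ e
  within-⊆ S⊆S′ (s , t) = S⊆S′ s , S⊆S′ t

  joins-incident : ∀ {e u v} → Joins e u v → Incident e v
  joins-incident (inj₁ (_ , t)) = inj₂ t
  joins-incident (inj₂ (s , _)) = inj₁ s

  joins-within : ∀ {S e u v} → Joins e u v → u ∈ S → Within (v ∷ S) e
  joins-within (inj₁ (≡.refl , ≡.refl)) u∈S = there u∈S , here ≡.refl
  joins-within (inj₂ (≡.refl , ≡.refl)) u∈S = here ≡.refl , there u∈S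

  incident-joins : ∀ {S f v} → Within (v ∷ S) f → Incident f v → ∃[ u ] (u ∈ S × Joins f u v)
  incident-joins {f = f} (_ , here t)  (inj₁ s) = contradiction (≡.trans s (≡.sym t)) (loopless f)
  incident-joins         (_ , there t) (inj₁ s) = _ , t , inj₂ (s , ≡.refl)
  incident-joins {f = f} (here s , _)  (inj₂ t) = contradiction (≡.trans s (≡.sym t)) (loopless f)
  incident-joins         (there s , _) (inj₂ t) = _ , s , inj₁ (≡.refl , t)

  -- The vertex sets obtained from a root by attaching one vertex at a time.
  data Grown (r : Fin n) : List (Fin n) → Set where
    root : Grown r (r ∷ [])
    grow : ∀ {S u v e} → Grown r S → u ∈ S → v ∉ S → Joins e u v → Grown r (v ∷ S)

  root∈ : ∀ {r S} → Grown r S → r ∈ S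
  root∈ root           = here ≡.refl
  root∈ (grow g _ _ _) = there (root∈ g)

  -- Since the path stays inside `S`, a vertex outside `S` can be attached to either end without
  -- spoiling simplicity.
  grown-path : ∀ {r S u v} → Grown r S → u ∈ S → v ∈ S → ∃[ p ] (Path u v p × u ∷ p ⊆ S)
  grown-path root (here ≡.refl) (here ≡.refl) = [] , [] , id
  grown-path (grow g _ _ _) (here ≡.refl) (here ≡.refl) = [] , [] , λ { (here eq) → here eq }
  grown-path (grow g _ _ _) (there u∈) (there v∈) =
    let p , P , p⊆ = grown-path g u∈ v∈ in p , P , there ∘ p⊆
  grown-path (grow g w∈ x∉ j) (here ≡.refl) (there v∈) =
    let p , P , p⊆ = grown-path g w∈ v∈
    in _ , step (adjacent-sym (_ , j)) P (x∉ ∘ p⊆) ,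
       λ { (here eq) → here eq ; (there y∈) → there (p⊆ y∈) }
  grown-path {u = u} (grow {S} {v = x} g w∈ x∉ j) (there u∈) (here ≡.refl) =
    let p , P , p⊆ = grown-path g u∈ w∈ in _ , snoc P (_ , j) (x∉ ∘ p⊆) , snoc⊆ p p⊆
    where
    snoc⊆ : ∀ p → u ∷ p ⊆ S → u ∷ p ++ x ∷ [] ⊆ x ∷ S
    snoc⊆ p p⊆ y∈ with ∈-++⁻ (u ∷ p) y∈
    ... | inj₁ y∈p       = there (p⊆ y∈p)
    ... | inj₂ (here eq) = here eq

  -- If `v` had two distinct neighbours in `S`, a path between them inside `S` would close to a
  -- cycle through `v`. With equal neighbours, `simple` applies.
  link-unique : ∀ {r S u u′ v e f} → Grown r S → v ∉ S → u ∈ S → Joins e u v →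
                u′ ∈ S → Joins f u′ v → f ≡ e
  link-unique {u = u} {u′} g v∉ u∈ j u′∈ j′ with u FinP.≟ u′
  ... | yes ≡.refl = joins-unique j j′
  ... | no u≢u′ with grown-path g u∈ u′∈
  ...   | [] , [] , _ = contradiction ≡.refl u≢u′
  ...   | _ ∷ _ , P , p⊆ = contradiction (_ , j′)
    (no-cycle (step (adjacent-sym (_ , j)) P (v∉ ∘ p⊆)) (ℕ.s≤s (ℕ.s≤s ℕ.z≤n)))

  new-edge : ∀ {r S u v e f} → Grown r S → u ∈ S → v ∉ S → Joins e u v →
             Within (v ∷ S) f → Incident f v → f ≡ e
  new-edge g u∈ v∉ j wf inc =
    let _ , u′∈ , j′ = incident-joins wf inc in link-unique g v∉ u∈ j u′∈ j′

  ¬within-root : ∀ {r e} → ¬ Within (r ∷ []) e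
  ¬within-root {e = e} (here s , here t) = loopless e (≡.trans s (≡.sym t))

  reach : ∀ {r S u v} → Grown r S → u ∈ S → Star Adjacent u v →
          ∃[ S′ ] (Grown r S′ × S ⊆ S′ × v ∈ S′)
  reach g u∈ Star.ε = _ , g , id , u∈
  reach {S = S} g u∈ (Star._◅_ {j = w} (e , j) walk) with w ∈? S
  ... | yes w∈ = reach g w∈ walk
  ... | no w∉  =
    let S′ , g′ , S⊆S′ , v∈ = reach (grow g u∈ w∉ j) (here ≡.refl) walk
    in S′ , g′ , S⊆S′ ∘ there , v∈

  -- Recursion on the vertices still to be reached, not on the complement of `S`, keeps termination
  -- structural.
  cover : ∀ r (L : List (Fin n)) → ∃[ S ] (Grown r S × L ⊆ S)
  cover r [] = _ , root , λ ()
  cover r (v ∷ L) =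
    let S , g , L⊆S = cover r L
        S′ , g′ , S⊆S′ , v∈ = reach g (root∈ g) (connected r v)
    in S′ , g′ , λ { (here ≡.refl) → v∈ ; (there x∈) → S⊆S′ (L⊆S x∈) }

  -- The endpoint of an edge that was attached later.
  child : ∀ {r S} → Grown r S → Fin m → Fin n
  -- A default value: no edge lies within a single vertex.
  child {r} root e = r
  child (grow {v = v} g _ _ _) e with incident? e v
  ... | yes _ = v
  ... | no _  = child g e

  module _ {r S u v e} (g : Grown r S) (u∈ : u ∈ S) (v∉ : v ∉ S) (j : Joins e u v) where
    child-new : ∀ {f} → Incident f v → child (grow g u∈ v∉ j) f ≡ v
    child-new {f} inc with incident? f v
    ... | yes _   = ≡.refl
    ... | no ¬inc = contradiction inc ¬inc

    child-old : ∀ {f} → ¬ Incident f v → child (grow g u∈ v∉ j) f ≡ child g f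
    child-old {f} ¬inc with incident? f v
    ... | yes inc = contradiction inc ¬inc
    ... | no _    = ≡.refl

  child-incident : ∀ {r S e} (g : Grown r S) → Within S e → Incident e (child g e)
  child-incident {e = e} root wf = contradiction wf (¬within-root {e = e})
  child-incident {e = e} (grow {v = v} g _ _ _) wf with incident? e v
  ... | yes inc = inc
  ... | no ¬inc = child-incident g (within-tail wf ¬inc)

  child∈ : ∀ {r S e} (g : Grown r S) → Within S e → child g e ∈ S
  child∈ g wf = within-incident wf (child-incident g wf)

  child≢root : ∀ {r S e} (g : Grown r S) → Within S e → child g e ≢ r
  child≢root {e = e} root wf = contradiction wf (¬within-root {e = e})
  child≢root {e = e} (grow {v = v} g _ v∉ _) wf with incident? e v
  ... | yes _   = λ { ≡.refl → v∉ (root∈ g) }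
  ... | no ¬inc = child≢root g (within-tail wf ¬inc)

  -- Edges with a common later endpoint both attach it to the earlier set, and `new-edge` leaves
  -- room for only one.
  child-injective : ∀ {r S e f} (g : Grown r S) → Within S e → Within S f →
                    child g e ≡ child g f → e ≡ f
  child-injective {e = e} root we wf eq = contradiction we (¬within-root {e = e})
  child-injective {e = e} {f} (grow {v = v} g u∈ v∉ j) we wf eq
    with incident? e v | incident? f v
  ... | yes ie | yes jf = ≡.trans (new-edge g u∈ v∉ j we ie) (≡.sym (new-edge g u∈ v∉ j wf jf))
  ... | yes _  | no ¬if = contradiction (≡.subst (_∈ _) (≡.sym eq) (child∈ g (within-tail wf ¬if))) v∉
  ... | no ¬ie | yes _  = contradiction (≡.subst (_∈ _) eq (child∈ g (within-tail we ¬ie))) v∉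
  ... | no ¬ie | no ¬if = child-injective g (within-tail we ¬ie) (within-tail wf ¬if) eq

  child-surjective : ∀ {r S x} (g : Grown r S) → x ∈ S → x ≢ r →
                     ∃[ e ] (Within S e × child g e ≡ x)
  child-surjective root (here eq) x≢r = contradiction eq x≢r
  child-surjective (grow g u∈ v∉ j) (here ≡.refl) x≢r =
    _ , joins-within j u∈ , child-new g u∈ v∉ j (joins-incident j)
  child-surjective (grow g u∈ v∉ j) (there x∈) x≢r =
    let e , we , eq = child-surjective g x∈ x≢r
    in e , within-⊆ there we ,
       ≡.trans (child-old g u∈ v∉ j (v∉ ∘ within-incident we)) eq

  -- Leaf stripping: the vertex attached last is incident with one edge only.
  eliminate-within : ∀ {r S} (g : Grown r S) (P : Fin m → Set) →
    (∀ e → Within S e → (∀ f → Incident f (child g e) → f ≢ e → P f) → P e) →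
    (∀ e → ¬ Within S e → P e) → ∀ e → P e
  eliminate-within root P strip outside e = outside e (¬within-root {e = e})
  -- `outside` accumulates the edges already settled: the only edge at `v` within `v ∷ S` is settled
  -- next, and the recursion continues in `S`.
  eliminate-within {S = v ∷ S} (grow {e = e₀} g u∈ v∉ j) P strip outside =
    eliminate-within g P strip′ outside′
    where
    strip′ : ∀ e → Within S e → (∀ f → Incident f (child g e) → f ≢ e → P f) → P e
    strip′ e we h = strip e (within-⊆ there we) λ f inc →
      h f (≡.subst (Incident f) (child-old g u∈ v∉ j (v∉ ∘ within-incident we)) inc)

    leaf : P e₀
    leaf = strip e₀ (joins-within j u∈) λ f inc f≢e₀ → outside f λ wf →
      f≢e₀ (new-edge g u∈ v∉ j wf
        (≡.subst (Incident f) (child-new g u∈ v∉ j (joins-incident j)) inc))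

    outside′ : ∀ e → ¬ Within S e → P e
    outside′ e ¬we with within? (v ∷ S) e
    ... | no ¬we′ = outside e ¬we′
    ... | yes we′ with incident? e v
    ...   | yes inc = ≡.subst P (≡.sym (new-edge g u∈ v∉ j we′ inc)) leaf
    ...   | no ¬inc = contradiction (within-tail we′ ¬inc) ¬we

  -- What remains of the growth order once all vertices are included. `lower e` is the end of `e`
  -- farther from `r`, and `eliminate` is induction from the leaves towards `r`: the other edges at
  -- `lower e` lead to its children.
  record Rooting (r : Fin n) : Set₁ where
    field
      lower      : Fin m → Fin n
      incident   : ∀ e → Incident e (lower e)
      lower≢root : ∀ e → lower e ≢ r
      injective  : Injective _≡_ _≡_ lower
      surjective : ∀ v → v ≢ r → ∃[ e ] lower e ≡ v
      eliminate  : (P : Fin m → Set) →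
                   (∀ e → (∀ f → Incident f (lower e) → f ≢ e → P f) → P e) → ∀ e → P e

  rooting : ∀ r → Rooting r
  rooting r = let S , g , all⊆S = cover r (allFin n)
                  within : ∀ e → Within S e
                  within e = all⊆S (∈-allFin (src e)) , all⊆S (∈-allFin (tgt e))
              in record
    { lower      = child g
    ; incident   = λ e → child-incident g (within e)
    ; lower≢root = λ e → child≢root g (within e)
    ; injective  = child-injective g (within _) (within _)
    ; surjective = λ v v≢r → let e , _ , eq = child-surjective g (all⊆S (∈-allFin v)) v≢r in e , eq
    ; eliminate  = λ P strip → eliminate-within g P (λ e _ → strip e)
                     (λ e ¬we → contradiction (within e) ¬we)
    }

  -- For the root `zero`, `lower` is a bijection from the edges to the remaining vertices; each
  -- direction, being injective, gives one inequality.
  order≡1+size : 1 ℕ.≤ n → n ≡ suc m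
  order≡1+size (ℕ.s≤s {n = k} _) = ≡.cong suc (ℕP.≤-antisym
    (FinP.injective⇒≤ {f = λ i → proj₁ (surjective (suc i) λ ())} λ {i} {i′} eq →
      FinP.suc-injective (≡.trans (≡.sym (proj₂ (surjective (suc i) λ ())))
        (≡.trans (≡.cong lower eq) (proj₂ (surjective (suc i′) λ ())))))
    (FinP.injective⇒≤ {f = λ e → punchOut (lower≢root e ∘ ≡.sym)} λ {e} {f} eq →
      injective (FinP.punchOut-injective (lower≢root e ∘ ≡.sym) (lower≢root f ∘ ≡.sym) eq)))
    where open Rooting (rooting zero)

-- The unique matching of edges with the vertices other than the root

module RootedTrees {m} (T : OrientedTree (suc m) m) (r : Fin (suc m)) where
  open Trees T
  open Rooting (rooting r) public

  index : Fin m → Fin m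
  index e = punchOut (lower≢root e ∘ ≡.sym)

  punchIn-index : ∀ e → punchIn r (index e) ≡ lower e
  punchIn-index e = FinP.punchIn-punchOut (lower≢root e ∘ ≡.sym)

  edge : Fin m → Fin m
  edge i = proj₁ (surjective (punchIn r i) (FinP.punchInᵢ≢i r i))

  lower-edge : ∀ i → lower (edge i) ≡ punchIn r i
  lower-edge i = proj₂ (surjective (punchIn r i) (FinP.punchInᵢ≢i r i))

  edge-index : ∀ e → edge (index e) ≡ e
  edge-index e = injective (≡.trans (lower-edge (index e)) (punchIn-index e))

  index-edge : ∀ i → index (edge i) ≡ i
  index-edge i = FinP.punchIn-injective r _ _ (≡.trans (punchIn-index (edge i)) (lower-edge i))

  edges : Permutation′ m
  edges = permutation edge index edge-index index-edge

  Support : Fin m → Fin m → Set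
  Support i e = Incident e (punchIn r i)

  edge-transversal : IsTransversal Support edge
  edge-transversal = record
    { injective = λ {i} {k} eq →
        ≡.trans (≡.sym (index-edge i)) (≡.trans (≡.cong index eq) (index-edge k))
    ; supported = λ i → ≡.subst (Incident (edge i)) (lower-edge i) (incident (edge i))
    }

  -- If `σ` gave the row of `lower e` an edge `f` other than `e`, then `f` would come from a child
  -- and, by induction, already belong to its own row, against injectivity.
  edge-unique : ∀ σ → IsTransversal Support σ → σ ≗ edge
  edge-unique σ t i = ≡.trans
    (≡.cong σ (≡.sym (index-edge i)))
    (eliminate (λ e → σ (index e) ≡ e) strip (edge i))
    where
    open IsTransversal t using (supported) renaming (injective to σ-injective)
    strip : ∀ e → (∀ f → Incident f (lower e) → f ≢ e → σ (index f) ≡ f) → σ (index e) ≡ e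
    strip e ih with σ (index e) FinP.≟ e
    ... | yes eq = eq
    ... | no neq = ≡.trans (≡.sym (edge-index f))
      (≡.trans (≡.cong edge (σ-injective eq)) (edge-index e))
      where
      f : Fin m
      f = σ (index e)
      eq : σ (index f) ≡ f
      eq = ih f (≡.subst (Incident f) (punchIn-index e) (supported (index e))) neq

-- Minors

increasing-none : ∀ {r n} → n ℕ.< r → increasing r n ≡ []
increasing-none {suc r} {zero}  _ = ≡.refl
increasing-none {suc r} {suc n} (ℕ.s≤s n<r)
  rewrite increasing-none n<r | increasing-none (ℕP.m<n⇒m<1+n n<r) = ≡.refl

-- The list is a singleton on the nose, but its entry is assembled by `Vector.∷` and is compared
-- with `id` pointwise.
increasing-identity : ∀ n → ∃[ g ] (increasing n n ≡ g ∷ [] × g ≗ id)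
increasing-identity zero = _ , ≡.refl , λ ()
increasing-identity (suc n) with increasing n n | increasing-identity n
... | _ | g , ≡.refl , g≗id rewrite increasing-none {suc n} {n} ℕP.≤-refl =
  _ , ≡.refl , λ { zero → ≡.refl ; (suc i) → ≡.cong suc (g≗id i) }

-- A subset of size n among n + 1 is fixed by the point it misses. The number of such maps and their
-- shape suffice for the sum, as all minors have the same modulus.
increasing-punchIn : ∀ n → length (increasing n (suc n)) ≡ suc n ×
                     All (λ f → ∃[ r ] f ≗ punchIn r) (increasing n (suc n))
increasing-punchIn zero = ≡.refl , (zero , λ ()) ∷ []
increasing-punchIn (suc n)
  with increasing-punchIn n | increasing (suc n) (suc n) | increasing-identity (suc n)
... | len , faces | _ | g , ≡.refl , g≗id =
    ≡.trans (ListP.length-++ (List.map _ (increasing n (suc n))))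
      (≡.trans (≡.cong (ℕ._+ 1) (≡.trans (ListP.length-map _ (increasing n (suc n))) len))
               (ℕP.+-comm (suc n) 1))
  , AllP.++⁺
      (AllP.map⁺ (All.map (λ { (r , eq) → suc r , λ { zero → ≡.refl ; (suc i) → ≡.cong suc (eq i) } })
                          faces))
      -- The one map that misses `zero`.
      ((zero , λ i → ≡.cong suc (g≗id i)) ∷ [])

sum-constant : ∀ {A B : Set} {h : A × B → ℝ} {g gs c} (fs : List A) → gs ≡ g ∷ [] →
               All (λ f → h (f , g) ≈ᵣ c) fs →
               List.foldr _+ᵣ_ 0ᵣ (List.map h (cartesianProduct fs gs)) ≈ᵣ length fs ×ᵣ c
sum-constant []       ≡.refl []       = ≈ᵣ-refl
sum-constant (f ∷ fs) ≡.refl (p ∷ ps) = +ᵣ-cong p (sum-constant fs ≡.refl ps)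

-- Rank and maximal minors of the incidence matrix

open Determinants ℂ-commutativeRing

module _ {m} (T : OrientedTree (suc m) m) (w : Fin m → ℂ) (w≉0 : ∀ e → ¬ (w e ≈ᶜ 0ᶜ))
         (N : Matrix (suc m) m) (incidence : IsSignlessIncidenceMatrix T w N) where
  open Trees T using (Incident; incident?)
  open IsSignlessIncidenceMatrix incidence
  open CommutativeRing ℂ-commutativeRing
    using (setoid; sym; trans; reflexive; zeroˡ; zeroʳ; *-cong; *-congˡ; *-congʳ; *-commutativeMonoid)
  open CommutativeMonoidSum *-commutativeMonoid
    using () renaming (sum-permute to product-permute; sum-cong-≗ to product-cong-≗)

  not-incident : ∀ {e i} → ¬ Incident e i → N i e ≈ᶜ 0ᶜ
  not-incident {e} {i} ¬inc = off i e (¬inc ∘ inj₁ ∘ ≡.sym) (¬inc ∘ inj₂ ∘ ≡.sym)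

  -- The orientation drops out here: `normSq` does not distinguish a weight from its conjugate.
  normSq-entry² : ∀ {e i} → Incident e i → normSq (N i e *ᶜ N i e) ≈ᵣ normSq (w e)
  normSq-entry² {e} (inj₁ ≡.refl) = normSq-cong (IsPrincipalSqrt.isRoot (at-src e))
  normSq-entry² {e} (inj₂ ≡.refl) =
    ≈ᵣ-trans (normSq-cong (IsPrincipalSqrt.isRoot (at-tgt e))) (normSq-conj (w e))

  entry≉0 : ∀ {e i} → Incident e i → ¬ (N i e ≈ᶜ 0ᶜ)
  entry≉0 {e} {i} inc N≈0 = w≉0 e (normSq≈0⇒≈0 (≈ᵣ-trans (≈ᵣ-sym (normSq-entry² inc))
    (≈ᵣ-trans (normSq-cong (trans (*-congʳ N≈0) (zeroˡ (N i e)))) normSq-0)))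

  -- Row `lower e` of the combination collapses to the term of `e`: the other edges at `lower e`
  -- have coefficient 0 by induction, and all remaining edges have entry 0 there.
  columns-independent : LinearlyIndependent (column N)
  columns-independent a Na≈0 = eliminate (λ e → a e ≈ᶜ 0ᶜ) λ e later →
    *ᶜ-cancelʳ-0 (trans (sym (sum-single _ e (vanish e later))) (Na≈0 (lower e)))
                 (entry≉0 (incident e))
    where
    -- Any root would serve; `zero` is a vertex at hand.
    open RootedTrees T zero
    vanish : ∀ e → (∀ f → Incident f (lower e) → f ≢ e → a f ≈ᶜ 0ᶜ) →
             ∀ f → f ≢ e → a f *ᶜ N (lower e) f ≈ᶜ 0ᶜ
    vanish e later f f≢e with incident? f (lower e)
    ... | yes inc = trans (*-congʳ (later f inc f≢e)) (zeroˡ (N (lower e) f))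
    ... | no ¬inc = trans (*-congˡ {a f} (not-incident ¬inc)) (zeroʳ (a f))

  hasRank : HasRank N m
  hasRank = record
    { basis         = column N
    ; independent   = columns-independent
    ; inColumnSpace = v∈Span (column N)
    ; spanning      = v∈Span (column N)
    }

  ∣minor∣² : ∀ r {f g} → f ≗ punchIn r → g ≗ id →
             ∣ det (submatrix f g N) ∣ᶜ *ᵣ ∣ det (submatrix f g N) ∣ᶜ ≈ᵣ ∣ productᶜ w ∣ᶜ
  ∣minor∣² r {f} {g} f≗ g≗ = normSq²⇒∣∣ (≈ᵣ-trans (normSq-cong det²)
    (normSq-product λ e → normSq-entry² (incident e)))
    where
    open RootedTrees T r
    open SetoidReasoning setoid

    B : Matrix m m
    B = submatrix (punchIn r) id N

    entry² : Fin m → ℂ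
    entry² e = N (lower e) e *ᶜ N (lower e) e

    det≈ : det (submatrix f g N) ≈ᶜ det B
    det≈ = det-cong λ i j → reflexive (≡.cong₂ N (f≗ i) (g≗ j))

    det² : det (submatrix f g N) *ᶜ det (submatrix f g N) ≈ᶜ productᶜ entry²
    det² = begin
      det (submatrix f g N) *ᶜ det (submatrix f g N)
        ≈⟨ *-cong det≈ det≈ ⟩
      det B *ᶜ det B
        ≈⟨ det²-uniqueTransversal (λ i e → incident? e (punchIn r i)) (λ i e → not-incident)
             edge-transversal edge-unique ⟩
      productᶜ (λ i → B i (edge i) *ᶜ B i (edge i))
        ≡⟨ product-cong-≗ (λ i → ≡.cong (λ v → N v (edge i) *ᶜ N v (edge i)) (lower-edge i)) ⟨
      productᶜ (entry² ∘ edge)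
        -- From a product over rows to one over edges, the index set of the product of the weights.
        ≈⟨ product-permute entry² edges ⟨
      productᶜ entry² ∎

  sumOfSquaredMinors≈ : sumOfSquaredMinors m N ≈ᵣ suc m ×ᵣ ∣ productᶜ w ∣ᶜ
  sumOfSquaredMinors≈ =
    let g , eq , g≗id = increasing-identity m
        len , faces   = increasing-punchIn m
    in ≡.subst (λ k → sumOfSquaredMinors m N ≈ᵣ k ×ᵣ ∣ productᶜ w ∣ᶜ) len
         (sum-constant (increasing m (suc m)) eq
           (All.map (λ { (r , f≗) → ∣minor∣² r f≗ g≗id }) faces))

open import Data.Nat.Base using (_≤_)

theorem4p2 : ∀ (n m : ℕ) → 2 ≤ n → (T : OrientedTree n m) (w : Fin m → ℂ) →
    (∀ e → ¬ (w e ≈ᶜ 0ᶜ)) → (∀ e → ¬ (w e ∈ℝ⁻)) →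
    (N : Matrix n m) → IsSignlessIncidenceMatrix T w N →
    IsVol² N (n ×ᵣ ∣ productᶜ w ∣ᶜ)
theorem4p2 n m 2≤n T w w≉0 _ N incidence
  -- Minors of size `m` omit exactly one row once `n` is literally `suc m`; then `2 ≤ n` also says
  -- that the rank `m` is positive.
  with Trees.order≡1+size T (ℕP.≤-trans (ℕ.s≤s ℕ.z≤n) 2≤n)
... | ≡.refl = m , hasRank T w w≉0 N incidence , ℕ.s≤s⁻¹ 2≤n
             , sumOfSquaredMinors≈ T w w≉0 N incidence
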